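{- Let $R$ be an integral domain with $\operatorname{char} R\neq 2$. Let $\mathcal{A}_1$ and $\mathcal{A}_2$ be central real hyperplane arrangements, and suppose that $\mathcal{A}_1$ is generic in codimension $2$. If $\mathrm{VG}(\mathcal{A}_1)_R\simeq \mathrm{VG}(\mathcal{A}_2)_R$ as filtered $R$-algebras, then the tope graphs $\mathrm{Tope}(\mathcal{A}_1)$ and $\mathrm{Tope}(\mathcal{A}_2)$ are isomorphic as graphs.
   Context: A central real arrangement $\mathcal{A}=\{H_1,\dots,H_n\}$ is a finite set of distinct linear hyperplanes in $V=\mathbb{R}^\ell$, $H_i=\alpha_i^{ -1}(0)$ with $\alpha_i\in V^*$; write $H_i^+=\alpha_i^{ -1}(\mathbb{R}_{>0})$, $H_i^-=\alpha_i^{ -1}(\mathbb{R}_{<0})$. Its chambers $\mathrm{ch}(\mathcal{A})$ are the connected components of $V\setminus\bigcup_i H_i$. The Varchenko–Gelfand algebra $\mathrm{VG}(\mathcal{A})_R$ is the $R$-algebra of all functions $\mathrm{ch}(\mathcal{A})\to R$ with pointwise operations. The Heaviside function $x_i^+$ (resp. $x_i^-$) takes value $1$ on chambers contained in $H_i^+$ (resp. $H_i^-$) and $0$ elsewhere. The VG filtration is $\mathrm{Fil}^{ -1}=0$ and, for $k\ge 0$, $\mathrm{Fil}^k\mathrm{VG}(\mathcal{A})$ is the set of elements $G(x_1^+,\dots,x_n^+)$ with $G\in R[z_1,\dots,z_n]$ of degree $\le k$. A filtered $R$-algebra isomorphism is an $R$-algebra isomorphism $\varphi$ with $\varphi(\mathrm{Fil}^k)=\mathrm{Fil}^k$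 for all $k$. The tope graph $\mathrm{Tope}(\mathcal{A})$ has vertex set $\mathrm{ch}(\mathcal{A})$, with $C,C'$ adjacent iff exactly one hyperplane of $\mathcal{A}$ separates them. $\mathcal{A}$ is generic in codimension $2$ if every codimension-$2$ subspace of $V$ that is an intersection of hyperplanes of $\mathcal{A}$ is contained in exactly two hyperplanes of $\mathcal{A}$. -}

module Defs where

open import Level using (Level; _⊔_) renaming (suc to lsuc; zero to 0ℓ)
open import Data.Nat using (ℕ; zero; suc) renaming (_⊔_ to _⊔ℕ_; _≤_ to _≤ℕ_; _+_ to _+ℕ_)
open import Data.Fin using (Fin; zero; suc)
open import Data.Bool using (Bool; true; false)
open import Data.Product using (Σ; Σ-syntax; _×_; _,_; proj₁; proj₂)
open import Data.Sum using (_⊎_)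
open import Data.Empty using (⊥)
open import Relation.Nullary using (¬_)
open import Relation.Binary.PropositionalEquality using (_≡_; _≢_)
open import Relation.Binary.Definitions using (Tri; tri<; tri≈; tri>)
open import Relation.Binary.Structures using (IsStrictTotalOrder)
open import Algebra.Structures using (IsCommutativeRing)
open import Algebra.Bundles using (CommutativeRing)
open import Function using (_∘_)

-- A model of the real numbers: a Dedekind-complete ordered field.
-- (Agda's standard library has no reals; we quantify over every model
-- of the axioms of ℝ, all of which are isomorphic to ℝ classically.)

record RealModel : Set₁ where
  infixl 6 _+_
  infixl 7 _*_
  infix 4 _<_ _≤_
  field
    Carrier : Set
    _+_ _*_ : Carrier → Carrier → Carrier
    -_      : Carrier → Carrier
    0# 1#   : Carrier
    _<_     : Carrier → Carrier → Set
    isCommutativeRing : IsCommutativeRing _≡_ _+_ _*_ -_ 0# 1#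
    0≢1     : 0# ≢ 1#
    inverse : ∀ x → x ≢ 0# → Σ[ y ∈ Carrier ] (x * y ≡ 1#)
    isStrictTotalOrder : IsStrictTotalOrder _≡_ _<_
    +-mono-< : ∀ {x y} z → x < y → x + z < y + z
    *-pos    : ∀ {x y} → 0# < x → 0# < y → 0# < x * y

  _≤_ : Carrier → Carrier → Set
  x ≤ y = (x < y) ⊎ (x ≡ y)

  field
    complete : (P : Carrier → Set) → Σ[ x ∈ Carrier ] P x →
               Σ[ b ∈ Carrier ] (∀ x → P x → x ≤ b) →
               Σ[ s ∈ Carrier ] ((∀ x → P x → x ≤ s) ×
                                 (∀ b → (∀ x → P x → x ≤ b) → s ≤ b))

  compare : ∀ x y → Tri (x < y) (x ≡ y) (y < x)
  compare = IsStrictTotalOrder.compare isStrictTotalOrder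

IsIntegralDomain : ∀ {c ℓ} → CommutativeRing c ℓ → Set (c ⊔ ℓ)
IsIntegralDomain R = (¬ (1# ≈ 0#)) × (∀ a b → a * b ≈ 0# → (a ≈ 0#) ⊎ (b ≈ 0#))
  where open CommutativeRing R

CharNot2 : ∀ {c ℓ} → CommutativeRing c ℓ → Set ℓ
CharNot2 R = ¬ (1# + 1# ≈ 0#)
  where open CommutativeRing R

-- Polynomials in n variables over A (syntax trees) with their degree
-- (an element has degree ≤ k iff it is represented by a tree with deg ≤ k).
data Poly {c} (A : Set c) (n : ℕ) : Set c where
  con  : A → Poly A n
  var  : Fin n → Poly A n
  _⊕_  : Poly A n → Poly A n → Poly A n
  _⊗_  : Poly A n → Poly A n → Poly A n

deg : ∀ {c} {A : Set c} {n} → Poly A n → ℕ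
deg (con _) = 0
deg (var _) = 1
deg (p ⊕ q) = deg p ⊔ℕ deg q
deg (p ⊗ q) = deg p +ℕ deg q

evalPoly : ∀ {c ℓ} (R : CommutativeRing c ℓ) {n} →
           Poly (CommutativeRing.Carrier R) n →
           (Fin n → CommutativeRing.Carrier R) → CommutativeRing.Carrier R
evalPoly R (con a) z = a
evalPoly R (var i) z = z i
evalPoly R (p ⊕ q) z = CommutativeRing._+_ R (evalPoly R p z) (evalPoly R q z)
evalPoly R (p ⊗ q) z = CommutativeRing._*_ R (evalPoly R p z) (evalPoly R q z)

module Arr (ℝ : RealModel) where
  open RealModel ℝ

  Vect : ℕ → Set
  Vect ℓ = Fin ℓ → Carrier

  Form : ℕ → Set
  Form ℓ = Fin ℓ → Carrier

  sumFin : ∀ {ℓ} → (Fin ℓ → Carrier) → Carrier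
  sumFin {zero}  f = 0#
  sumFin {suc ℓ} f = f zero + sumFin (f ∘ suc)

  ev : ∀ {ℓ} → Form ℓ → Vect ℓ → Carrier
  ev a v = sumFin (λ j → a j * v j)

  _⇔_ : Set → Set → Set
  P ⇔ Q = (P → Q) × (Q → P)

  record Arrangement (ℓ n : ℕ) : Set where
    field
      α        : Fin n → Form ℓ
      nonzero  : ∀ i → ¬ (∀ j → α i j ≡ 0#)
      distinct : ∀ i j → i ≢ j →
                 ¬ (∀ v → (ev (α i) v ≡ 0#) ⇔ (ev (α j) v ≡ 0#))

  IsOpen : ∀ {ℓ} → (Vect ℓ → Set) → Set
  IsOpen {ℓ} U = ∀ x → U x → Σ[ ε ∈ Carrier ] ((0# < ε) ×
      (∀ (y : Vect ℓ) → (∀ j → (x j + - ε < y j) × (y j < x j + ε)) → U y))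

  IsConnected : ∀ {ℓ} → (Vect ℓ → Set) → Set₁
  IsConnected {ℓ} S = ¬ (Σ[ U ∈ (Vect ℓ → Set) ] Σ[ W ∈ (Vect ℓ → Set) ]
      (IsOpen U × IsOpen W × (∀ x → S x → U x ⊎ W x) ×
       (∀ x → S x → U x → W x → ⊥) ×
       (Σ[ x ∈ Vect ℓ ] (S x × U x)) × (Σ[ x ∈ Vect ℓ ] (S x × W x))))

  module _ {ℓ n : ℕ} (A : Arrangement ℓ n) where
    open Arrangement A

    InM : Vect ℓ → Set
    InM v = ∀ i → ev (α i) v ≢ 0#

    Point : Set
    Point = Σ[ v ∈ Vect ℓ ] InM v

    SameChamber : Point → Point → Set₁
    SameChamber p q = Σ[ S ∈ (Vect ℓ → Set) ]
      ((∀ x → S x → InM x) × S (proj₁ p) × S (proj₁ q) × IsConnected S)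

    Separates : Fin n → Point → Point → Set
    Separates i p q =
      ((0# < ev (α i) (proj₁ p)) × (ev (α i) (proj₁ q) < 0#)) ⊎
      ((ev (α i) (proj₁ p) < 0#) × (0# < ev (α i) (proj₁ q)))

    Adjacent : Point → Point → Set
    Adjacent p q = Σ[ i ∈ Fin n ] (Separates i p q × (∀ j → Separates j p q → j ≡ i))

    IsCodim2 : (Vect ℓ → Set) → Set
    IsCodim2 X = Σ[ β₁ ∈ Form ℓ ] Σ[ β₂ ∈ Form ℓ ]
      ((∀ λ₁ λ₂ → (∀ j → λ₁ * β₁ j + λ₂ * β₂ j ≡ 0#) → (λ₁ ≡ 0#) × (λ₂ ≡ 0#)) ×
       (∀ v → X v ⇔ ((ev β₁ v ≡ 0#) × (ev β₂ v ≡ 0#))))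

    IsIntersectionOfHyperplanes : (Vect ℓ → Set) → Set
    IsIntersectionOfHyperplanes X = Σ[ S ∈ (Fin n → Bool) ]
      (∀ v → X v ⇔ (∀ i → S i ≡ true → ev (α i) v ≡ 0#))

    ContainedIn : (Vect ℓ → Set) → Fin n → Set
    ContainedIn X i = ∀ v → X v → ev (α i) v ≡ 0#

    GenericCodim2 : Set₁
    GenericCodim2 = ∀ (X : Vect ℓ → Set) → IsCodim2 X → IsIntersectionOfHyperplanes X →
      Σ[ i ∈ Fin n ] Σ[ j ∈ Fin n ] ((i ≢ j) × ContainedIn X i × ContainedIn X j ×
        (∀ k → ContainedIn X k → (k ≡ i) ⊎ (k ≡ j)))

  -- Tope graph isomorphism (vertices = chambers = points mod SameChamber)

  TopeGraphIso : ∀ {ℓ₁ n₁ ℓ₂ n₂} → Arrangement ℓ₁ n₁ → Arrangement ℓ₂ n₂ → Set₁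
  TopeGraphIso A₁ A₂ = Σ[ ψ ∈ (Point A₁ → Point A₂) ]
    ((∀ p q → SameChamber A₁ p q → SameChamber A₂ (ψ p) (ψ q)) ×
     (∀ p q → SameChamber A₂ (ψ p) (ψ q) → SameChamber A₁ p q) ×
     (∀ r → Σ[ p ∈ Point A₁ ] SameChamber A₂ (ψ p) r) ×
     (∀ p q → Adjacent A₁ p q ⇔ Adjacent A₂ (ψ p) (ψ q)))

  module VG {c ℓr} (R : CommutativeRing c ℓr) where
    module R = CommutativeRing R

    module _ {ℓ n : ℕ} (A : Arrangement ℓ n) where
      open Arrangement A

      record VGElt : Set (c ⊔ ℓr ⊔ lsuc 0ℓ) where
        field
          fun  : Point A → R.Carrier
          resp : ∀ p q → SameChamber A p q → fun p R.≈ fun q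
      open VGElt public

      _≈ᵥ_ : VGElt → VGElt → Set ℓr
      f ≈ᵥ g = ∀ p → fun f p R.≈ fun g p

      heaviside : ∀ {x} → Tri (0# < x) (0# ≡ x) (x < 0#) → R.Carrier
      heaviside (tri< _ _ _) = R.1#
      heaviside (tri≈ _ _ _) = R.0#
      heaviside (tri> _ _ _) = R.0#

      xplus : Fin n → Point A → R.Carrier
      xplus i p = heaviside (compare 0# (ev (α i) (proj₁ p)))

      InFil : ℕ → VGElt → Set (c ⊔ ℓr)
      InFil k f = Σ[ G ∈ Poly R.Carrier n ]
        ((deg G ≤ℕ k) × (∀ p → fun f p R.≈ evalPoly R G (λ i → xplus i p)))

    module _ {ℓ n : ℕ} {A : Arrangement ℓ n} where
      _+ᵥ_ : VGElt A → VGElt A → Point A → R.Carrier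
      (f +ᵥ g) p = fun f p R.+ fun g p

      _*ᵥ_ : VGElt A → VGElt A → Point A → R.Carrier
      (f *ᵥ g) p = fun f p R.* fun g p

      _·ᵥ_ : R.Carrier → VGElt A → Point A → R.Carrier
      (r ·ᵥ f) p = r R.* fun f p

    FilteredAlgIso : ∀ {ℓ₁ n₁ ℓ₂ n₂} → Arrangement ℓ₁ n₁ → Arrangement ℓ₂ n₂ →
                     Set (c ⊔ ℓr ⊔ lsuc 0ℓ)
    FilteredAlgIso A₁ A₂ = Σ[ φ ∈ (VGElt A₁ → VGElt A₂) ]
      ( (∀ f g → _≈ᵥ_ A₁ f g → _≈ᵥ_ A₂ (φ f) (φ g))
      × (∀ f g h → (∀ p → fun h p R.≈ (f +ᵥ g) p) →
                   (∀ p → fun (φ h) p R.≈ (φ f +ᵥ φ g) p))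
      × (∀ f g h → (∀ p → fun h p R.≈ (f *ᵥ g) p) →
                   (∀ p → fun (φ h) p R.≈ (φ f *ᵥ φ g) p))
      × (∀ r f h → (∀ p → fun h p R.≈ (r ·ᵥ f) p) →
                   (∀ p → fun (φ h) p R.≈ (r ·ᵥ φ f) p))
      × (∀ e → (∀ p → fun e p R.≈ R.1#) → (∀ p → fun (φ e) p R.≈ R.1#))
      × (∀ f g → _≈ᵥ_ A₂ (φ f) (φ g) → _≈ᵥ_ A₁ f g)
      × (∀ g → Σ[ f ∈ VGElt A₁ ] _≈ᵥ_ A₂ (φ f) g)
      × (∀ k f → InFil A₁ k f → InFil A₂ k (φ f))
      × (∀ k g → InFil A₂ k g → Σ[ f ∈ VGElt A₁ ] (InFil A₁ k f × _≈ᵥ_ A₂ (φ f) g)) )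

{-# OPTIONS --safe #-}
module Submission where

-- Suppose an idempotent of Fil¹ depends on both xᵢ⁺ and xⱼ⁺. On the four chambers around a
-- generic point of Hᵢ ∩ Hⱼ it takes values c, c + a, c + b, c + a + b with a, b ≠ 0, which
-- cannot all be 0 or 1 in characteristic ≠ 2. So for an arrangement generic in codimension 2
-- the nonconstant idempotents of Fil¹ are the xᵢ⁺ and 1 − xᵢ⁺. The inverse of an algebra
-- isomorphism φ is pullback along a bijection ψ of chambers (φ maps the indicator of p to that
-- of ψ p), and since φ is filtered, xⱼ⁺ pulls back to x⁺_{σ j} or 1 − x⁺_{σ j}. Hence Hⱼ
-- separates ψ p from ψ q iff H_{σ j} separates p from q, and σ is a bijection.
--
-- Chambers are encoded by their sign patterns. Constructively, finding ψ p requires deciding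
-- which patterns are realized, that is, solving systems of strict linear inequalities.

open import Defs
open import Algebra.Bundles using (CommutativeRing)
import Algebra.Properties.CommutativeSemigroup
import Algebra.Properties.Ring
import Algebra.Properties.Semiring.Mult.TCOptimised
import Algebra.Solver.Ring
open import Algebra.Solver.Ring.AlmostCommutativeRing
  using (_-Raw-AlmostCommutative⟶_; fromCommutativeRing)
open import Data.Bool.Base using (Bool; true; false; _∨_)
open import Data.Bool.Properties using () renaming (_≟_ to _≟ᵇ_)
open import Data.Empty using (⊥; ⊥-elim)
open import Data.Fin.Base using (Fin; zero; suc)
open import Data.Fin.Properties using (any?; all?) renaming (_≟_ to _≟ᶠ_)
open import Data.Fin.Subset.Properties using (anySubset?)
open import Data.Integer.Base as ℤ using (ℤ; +_; -[1+_])
import Data.Integer.Properties as ℤ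
open import Data.Maybe.Base using (map)
open import Data.Nat.Base as ℕ using (ℕ; zero; suc; z≤n; s≤s) renaming (_≤_ to _≤ℕ_; _+_ to _+ℕ_)
open import Data.Nat.Properties using (m⊔n≤o⇒m≤o; m⊔n≤o⇒n≤o; m+n≤o⇒m≤o; m+n≤o⇒n≤o; ≤-refl)
open import Data.Product using (Σ-syntax; ∃; _×_; _,_; proj₁; proj₂)
open import Data.Sum.Base using (_⊎_; inj₁; inj₂; [_,_]′; map₂)
open import Data.Vec.Base using (lookup; tabulate)
open import Data.Vec.Functional using (_∷_)
open import Data.Vec.Properties using (lookup∘tabulate)
open import Function.Base using (_∘_)
open import Relation.Binary.Consequences using (dec⇒weaklyDec)
open import Relation.Binary.Definitions using (Tri; tri<; tri≈; tri>)
open import Relation.Binary.PropositionalEquality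
  using (_≡_; _≢_; refl; sym; trans; cong; cong₂; subst; subst₂; ≢-sym)
import Relation.Binary.Reasoning.Setoid
open import Relation.Binary.Structures using (IsStrictTotalOrder)
open import Relation.Nullary using (¬_; Dec; yes; no; contradiction)
open import Relation.Nullary.Decidable using (¬?; decidable-stable; isYes) renaming (map′ to mapDec)

-- Equality in `R` is not assumed decidable. Idempotents escape this: in a domain x(x - 1) = 0
-- yields x = 0 or x = 1, so asking whether an idempotent takes the value 1 becomes a search over
-- finitely many sign patterns. Degree at most 1 enters as a parallelogram identity, not through
-- coefficients: if z + w′ = z′ + w, then G(z) + G(w′) = G(z′) + G(w). Hence the jump of G in the
-- k-th coordinate is the same all over the Boolean cube, at realized and unrealized patterns alike,
-- and can be measured at one pair of chambers adjacent across the k-th hyperplane. The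
-- classification of idempotents is applied to the preimages under φ of the coordinates of `A₂`;
-- these lie in Fil¹ of `A₁`, the arrangement known to be generic. That both arrangements have
-- equally many hyperplanes is an outcome: σ is bijective because a pair of chambers adjacent across
-- one wall, in either arrangement, tells that wall from all others.

-- Ring identities with integer coefficients.

module IntegerCoefficientSolver {c ℓ} (R : CommutativeRing c ℓ) where
  private
    open module R = CommutativeRing R using (Carrier; _≈_; _+_; _*_; -_; 0#; 1#)
    open Algebra.Properties.Ring R.ring
    open Algebra.Properties.Semiring.Mult.TCOptimised R.semiring renaming (_×_ to _×ₙ_)
    open Relation.Binary.Reasoning.Setoid R.setoid

    -- The canonical map from the integers. Coefficients are taken there because integer constants
    -- can be compared by computation, unlike the abstract constants of the ring.
    ⟦_⟧ : ℤ → Carrier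
    ⟦ + n ⟧      = n ×ₙ 1#
    ⟦ -[1+ n ] ⟧ = - (suc n ×ₙ 1#)

    ⟦⟧-⊖ : ∀ m n → ⟦ m ℤ.⊖ n ⟧ ≈ m ×ₙ 1# + - (n ×ₙ 1#)
    ⟦⟧-⊖ m zero = R.sym (R.trans (R.+-congˡ -0#≈0#) (R.+-identityʳ _))
    ⟦⟧-⊖ zero (suc n) = R.sym (R.+-identityˡ _)
    ⟦⟧-⊖ (suc m) (suc n) = begin
      ⟦ suc m ℤ.⊖ suc n ⟧ ≡⟨ cong ⟦_⟧ (ℤ.[1+m]⊖[1+n]≡m⊖n m n) ⟩
      ⟦ m ℤ.⊖ n ⟧         ≈⟨ ⟦⟧-⊖ m n ⟩
      a + - b             ≈⟨ R.+-congʳ (//-rightDividesʳ 1# a) ⟨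
      a + 1# + - 1# + - b ≈⟨ R.+-assoc _ _ _ ⟩
      a + 1# + (- 1# + - b) ≈⟨ R.+-cong (R.+-comm _ _) (-‿+-comm _ _) ⟩
      (1# + a) + - (1# + b) ≈⟨ R.+-cong (1+× m 1#) (R.-‿cong (1+× n 1#)) ⟨
      suc m ×ₙ 1# + - (suc n ×ₙ 1#) ∎
      where
      a = m ×ₙ 1#
      b = n ×ₙ 1#

    ⟦⟧-neg : ∀ i → ⟦ ℤ.- i ⟧ ≈ - ⟦ i ⟧
    ⟦⟧-neg (+ zero)  = R.sym -0#≈0#
    ⟦⟧-neg (+ suc n) = R.refl
    ⟦⟧-neg -[1+ n ]  = R.sym (-‿involutive _)

    ⟦⟧-+ : ∀ i j → ⟦ i ℤ.+ j ⟧ ≈ ⟦ i ⟧ + ⟦ j ⟧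
    ⟦⟧-+ (+ m) (+ n) = ×-homo-+ 1# m n
    ⟦⟧-+ (+ m) -[1+ n ] = ⟦⟧-⊖ m (suc n)
    ⟦⟧-+ -[1+ m ] (+ n) = R.trans (⟦⟧-⊖ n (suc m)) (R.+-comm _ _)
    ⟦⟧-+ -[1+ m ] -[1+ n ] = begin
      ⟦ ℤ.- (+ suc m) ℤ.+ ℤ.- (+ suc n) ⟧ ≡⟨ cong ⟦_⟧ (ℤ.neg-distrib-+ (+ suc m) (+ suc n)) ⟨
      - ((suc m ℕ.+ suc n) ×ₙ 1#) ≈⟨ R.-‿cong (×-homo-+ 1# (suc m) (suc n)) ⟩
      - (suc m ×ₙ 1# + suc n ×ₙ 1#) ≈⟨ -‿+-comm _ _ ⟨
      - (suc m ×ₙ 1#) + - (suc n ×ₙ 1#) ∎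

    ⟦⟧-*+ : ∀ m j → ⟦ + m ℤ.* j ⟧ ≈ m ×ₙ 1# * ⟦ j ⟧
    ⟦⟧-*+ m (+ n) = R.trans (R.reflexive (cong ⟦_⟧ (sym (ℤ.pos-* m n)))) (×1-homo-* m n)
    ⟦⟧-*+ m -[1+ n ] = begin
      ⟦ + m ℤ.* ℤ.- (+ suc n) ⟧ ≡⟨ cong ⟦_⟧ (ℤ.neg-distribʳ-* (+ m) (+ suc n)) ⟨
      ⟦ ℤ.- (+ m ℤ.* + suc n) ⟧ ≈⟨ ⟦⟧-neg (+ m ℤ.* + suc n) ⟩
      - ⟦ + m ℤ.* + suc n ⟧ ≈⟨ R.-‿cong (⟦⟧-*+ m (+ suc n)) ⟩
      - (m ×ₙ 1# * (suc n ×ₙ 1#)) ≈⟨ -‿distribʳ-* _ _ ⟩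
      m ×ₙ 1# * - (suc n ×ₙ 1#) ∎

    ⟦⟧-* : ∀ i j → ⟦ i ℤ.* j ⟧ ≈ ⟦ i ⟧ * ⟦ j ⟧
    ⟦⟧-* (+ m) j = ⟦⟧-*+ m j
    ⟦⟧-* -[1+ m ] j = begin
      ⟦ ℤ.- (+ suc m) ℤ.* j ⟧ ≡⟨ cong ⟦_⟧ (ℤ.neg-distribˡ-* (+ suc m) j) ⟨
      ⟦ ℤ.- (+ suc m ℤ.* j) ⟧ ≈⟨ ⟦⟧-neg (+ suc m ℤ.* j) ⟩
      - ⟦ + suc m ℤ.* j ⟧ ≈⟨ R.-‿cong (⟦⟧-*+ (suc m) j) ⟩
      - (suc m ×ₙ 1# * ⟦ j ⟧) ≈⟨ -‿distribˡ-* _ _ ⟩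
      - (suc m ×ₙ 1#) * ⟦ j ⟧ ∎

    homomorphism : ℤ.+-*-rawRing -Raw-AlmostCommutative⟶ fromCommutativeRing R
    homomorphism = record
      { ⟦_⟧    = ⟦_⟧
      ; +-homo = ⟦⟧-+
      ; *-homo = ⟦⟧-*
      ; -‿homo = ⟦⟧-neg
      ; 0-homo = R.refl
      ; 1-homo = R.refl
      }

  open Algebra.Solver.Ring ℤ.+-*-rawRing (fromCommutativeRing R) homomorphism
    (λ i j → map (λ i≡j → R.reflexive (cong ⟦_⟧ i≡j)) (dec⇒weaklyDec ℤ._≟_ i j))
    public

-- Ordered field arithmetic, signs and small parameters.

module OrderedField (ℝ : RealModel) where
  open RealModel ℝ
  open IsStrictTotalOrder isStrictTotalOrder public
    using (irrefl; _≟_) renaming (trans to <-trans)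

  ring : CommutativeRing _ _
  ring = record { isCommutativeRing = isCommutativeRing }

  open CommutativeRing ring public
    using (+-comm; +-congˡ; +-congʳ; *-congˡ; *-comm;
           +-identityˡ; +-identityʳ; *-identityʳ; zeroʳ; zeroˡ; -‿inverseʳ)
  open IntegerCoefficientSolver ring public
    using (solve; con; _:=_; _:+_; _:*_; :-_)

  <-irrefl : ∀ {x} → ¬ (x < x)
  <-irrefl = irrefl refl

  <⇒≢ : ∀ {x y} → x < y → x ≢ y
  <⇒≢ x<y refl = <-irrefl x<y

  ≤-<-trans : ∀ {x y z} → x ≤ y → y < z → x < z
  ≤-<-trans (inj₁ p)    q = <-trans p q
  ≤-<-trans (inj₂ refl) q = q

  ≤-trans : ∀ {x y z} → x ≤ y → y ≤ z → x ≤ z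
  ≤-trans p (inj₁ q)    = inj₁ (≤-<-trans p q)
  ≤-trans p (inj₂ refl) = p

  ≤⇒≯ : ∀ {x y} → x ≤ y → ¬ (y < x)
  ≤⇒≯ p q = <-irrefl (≤-<-trans p q)

  ≮⇒≥ : ∀ {x y} → ¬ (x < y) → y ≤ x
  ≮⇒≥ {x} {y} x≮y with compare x y
  ... | tri< x<y _ _ = contradiction x<y x≮y
  ... | tri≈ _ x≡y _ = inj₂ (sym x≡y)
  ... | tri> _ _ y<x = inj₁ y<x

  x<y⇒0<y-x : ∀ {x y} → x < y → 0# < y + - x
  x<y⇒0<y-x {x} x<y = subst (_< _) (-‿inverseʳ x) (+-mono-< (- x) x<y)

  0<y-x⇒x<y : ∀ {x y} → 0# < y + - x → x < y
  0<y-x⇒x<y {x} {y} p = subst₂ _<_ (+-identityˡ x)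
    (solve 2 (λ x y → (y :+ :- x) :+ x := y) refl x y) (+-mono-< x p)

  0<-x : ∀ {x} → x < 0# → 0# < - x
  0<-x {x} x<0 = subst (0# <_) (+-identityˡ (- x)) (x<y⇒0<y-x x<0)

  -x<0 : ∀ {x} → 0# < x → - x < 0#
  -x<0 {x} 0<x = 0<y-x⇒x<y (subst (0# <_) (solve 1 (λ x → x := con (+ 0) :+ :- (:- x)) refl x) 0<x)

  0<-x⇒x<0 : ∀ {x} → 0# < - x → x < 0#
  0<-x⇒x<0 {x} p = subst (_< 0#) (solve 1 (λ x → :- (:- x) := x) refl x) (-x<0 p)

  0<x+y : ∀ {x y} → 0# < x → 0# < y → 0# < x + y
  0<x+y {x} {y} 0<x 0<y = <-trans 0<y (subst (_< x + y) (+-identityˡ y) (+-mono-< y 0<x))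

  0≤x⇒0<x+y : ∀ {x y} → 0# ≤ x → 0# < y → 0# < x + y
  0≤x⇒0<x+y (inj₁ 0<x) 0<y = 0<x+y 0<x 0<y
  0≤x⇒0<x+y {y = y} (inj₂ refl) 0<y = subst (0# <_) (sym (+-identityˡ y)) 0<y

  0≤xy : ∀ {x y} → 0# ≤ x → 0# < y → 0# ≤ x * y
  0≤xy (inj₁ 0<x) 0<y = inj₁ (*-pos 0<x 0<y)
  0≤xy {y = y} (inj₂ refl) 0<y = inj₂ (sym (zeroˡ y))

  0<1 : 0# < 1#
  0<1 with compare 0# 1#
  ... | tri< p _ _ = p
  ... | tri≈ _ p _ = contradiction p 0≢1
  ... | tri> _ _ p = subst (0# <_) (trans (solve 1 (λ o → :- o :* :- o := o :* o) refl 1#) (*-identityʳ 1#))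
                       (*-pos (0<-x p) (0<-x p))

  abstract
    positive-inverse : ∀ {x} → 0# < x → Σ[ y ∈ Carrier ] (0# < y) × (x * y ≡ 1#)
    positive-inverse {x} 0<x with inverse x (≢-sym (<⇒≢ 0<x))
    ... | y , xy≡1 with compare 0# y
    ... | tri< 0<y _ _ = y , 0<y , xy≡1
    ... | tri≈ _ refl _ = contradiction (trans (sym (zeroʳ x)) xy≡1) 0≢1
    ... | tri> _ _ y<0 = ⊥-elim (<-irrefl (<-trans 0<1 (subst (_< 0#) xy≡1
          (0<-x⇒x<0 (subst (0# <_) (solve 2 (λ x y → x :* :- y := :- (x :* y)) refl x y)
            (*-pos 0<x (0<-x y<0)))))))

    half : ∀ {x} → 0# < x → Σ[ y ∈ Carrier ] (0# < y) × (y + y ≡ x)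
    half {x} 0<x with positive-inverse (0<x+y 0<1 0<1)
    ... | i , 0<i , 2i≡1 = x * i , *-pos 0<x 0<i ,
      trans (solve 2 (λ x i → x :* i :+ x :* i := x :* ((con (+ 1) :+ con (+ 1)) :* i)) refl x i)
        (trans (cong (x *_) 2i≡1) (*-identityʳ x))

    lower-bound : ∀ {x y} → 0# < x → 0# < y → Σ[ z ∈ Carrier ] (0# < z) × (z ≤ x) × (z ≤ y)
    lower-bound {x} {y} 0<x 0<y with compare x y
    ... | tri< x<y _ _ = x , 0<x , inj₂ refl , inj₁ x<y
    ... | tri≈ _ x≡y _ = x , 0<x , inj₂ refl , inj₂ x≡y
    ... | tri> _ _ y<x = y , 0<y , inj₁ y<x , inj₂ refl

    -- Supplies a positive bound for `- b` that is strict, so that `small-pos` can divide by it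
    -- whatever the sign of `b`.
    dominates : ∀ b → Σ[ c ∈ Carrier ] (0# < c) × (0# < c + b)
    dominates b with compare b 0#
    ... | tri< b<0 _ _ = 1# + - b , 0<x+y 0<1 (0<-x b<0) ,
          subst (0# <_) (solve 1 (λ b → con (+ 1) := (con (+ 1) :+ :- b) :+ b) refl b) 0<1
    ... | tri≈ _ refl _ = 1# , 0<1 , subst (0# <_) (sym (+-identityʳ 1#)) 0<1
    ... | tri> _ _ 0<b = 1# , 0<1 , 0<x+y 0<1 0<b

  product≢0 : ∀ {x y} → x ≢ 0# → y ≢ 0# → x * y ≢ 0#
  product≢0 {x} {y} x≢0 y≢0 xy≡0 with inverse x x≢0
  ... | i , xi≡1 = y≢0 (trans
    (trans (sym (*-identityʳ y)) (trans (cong (y *_) (sym xi≡1))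
      (solve 3 (λ x y i → y :* (x :* i) := i :* (x :* y)) refl x y i)))
    (trans (cong (i *_) xy≡0) (zeroʳ i)))

  -- Defined on the outcome of the comparison, clause by clause like `heaviside`, so that sign
  -- patterns and Heaviside values agree by cases on one comparison.
  positive : ∀ {x} → Tri (0# < x) (0# ≡ x) (x < 0#) → Bool
  positive (tri< _ _ _) = true
  positive (tri≈ _ _ _) = false
  positive (tri> _ _ _) = false

  pos : Carrier → Bool
  pos x = positive (compare 0# x)

  0<x⇒pos : ∀ {x} → 0# < x → pos x ≡ true
  0<x⇒pos {x} 0<x with compare 0# x
  ... | tri< _ _ _ = refl
  ... | tri≈ 0≮x _ _ = contradiction 0<x 0≮x
  ... | tri> 0≮x _ _ = contradiction 0<x 0≮x

  x<0⇒¬pos : ∀ {x} → x < 0# → pos x ≡ false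
  x<0⇒¬pos {x} x<0 with compare 0# x
  ... | tri< _ _ x≮0 = contradiction x<0 x≮0
  ... | tri≈ _ _ _ = refl
  ... | tri> _ _ _ = refl

  pos⇒0<x : ∀ {x} → pos x ≡ true → 0# < x
  pos⇒0<x {x} _ with compare 0# x
  pos⇒0<x _  | tri< 0<x _ _ = 0<x
  pos⇒0<x () | tri≈ _ _ _
  pos⇒0<x () | tri> _ _ _

  ¬pos⇒x<0 : ∀ {x} → x ≢ 0# → pos x ≡ false → x < 0#
  ¬pos⇒x<0 {x} _ _ with compare 0# x
  ¬pos⇒x<0 _   () | tri< _ _ _
  ¬pos⇒x<0 x≢0 _  | tri≈ _ 0≡x _ = contradiction (sym 0≡x) x≢0
  ¬pos⇒x<0 _   _  | tri> _ _ x<0 = x<0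

  sign : Bool → Carrier
  sign true  = 1#
  sign false = - 1#

  sign≢0 : ∀ s → sign s ≢ 0#
  sign≢0 true  = ≢-sym (<⇒≢ 0<1)
  sign≢0 false = <⇒≢ (-x<0 0<1)

  pos-sign : ∀ s → pos (sign s) ≡ s
  pos-sign true  = 0<x⇒pos 0<1
  pos-sign false = x<0⇒¬pos (-x<0 0<1)

  -- With its converse `0<sign*`, this packs nonvanishing and a prescribed sign into one strict
  -- inequality, the form that `solvable?` can decide.
  0<sign*⇒ : ∀ s {x} → 0# < sign s * x → x ≢ 0# × pos x ≡ s
  0<sign*⇒ true {x} p = ≢-sym (<⇒≢ q) , 0<x⇒pos q
    where q = subst (0# <_) (solve 1 (λ x → con (+ 1) :* x := x) refl x) p
  0<sign*⇒ false {x} p = <⇒≢ q , x<0⇒¬pos q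
    where q = 0<-x⇒x<0 (subst (0# <_) (solve 1 (λ x → :- con (+ 1) :* x := :- x) refl x) p)

  0<sign* : ∀ s {x} → x ≢ 0# → pos x ≡ s → 0# < sign s * x
  0<sign* true {x} x≢0 e = subst (0# <_) (solve 1 (λ x → x := con (+ 1) :* x) refl x) (pos⇒0<x e)
  0<sign* false {x} x≢0 e =
    subst (0# <_) (solve 1 (λ x → :- x := :- con (+ 1) :* x) refl x) (0<-x (¬pos⇒x<0 x≢0 e))

  Small : (Carrier → Set) → Set
  Small P = Σ[ ε ∈ Carrier ] (0# < ε) × (∀ t → 0# < t → t ≤ ε → P t)

  abstract
    small-all : ∀ n {P : Fin n → Carrier → Set} → (∀ i → Small (P i)) → Small (λ t → ∀ i → P i t)
    small-all zero H = 1# , 0<1 , λ _ _ _ ()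
    small-all (suc n) H with H zero | small-all n (H ∘ suc)
    ... | ε₀ , 0<ε₀ , h₀ | ε₁ , 0<ε₁ , h₁ with lower-bound 0<ε₀ 0<ε₁
    ... | ε , 0<ε , ε≤ε₀ , ε≤ε₁ = ε , 0<ε , λ where
      t 0<t t≤ε zero    → h₀ t 0<t (≤-trans t≤ε ε≤ε₀)
      t 0<t t≤ε (suc i) → h₁ t 0<t (≤-trans t≤ε ε≤ε₁) i

    -- Take `c` with `c` and `c + b` both positive and split `a + t * b` as
    -- `(a - t * c) + t * (c + b)`. The threshold `a * i` is `a` divided by `c`, up to which the
    -- first summand is nonnegative.
    small-pos : ∀ {a} b → 0# < a → Small (λ t → 0# < a + t * b)
    small-pos {a} b 0<a with dominates b
    ... | c , 0<c , 0<c+b with positive-inverse 0<c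
    ... | i , 0<i , ci≡1 = a * i , *-pos 0<a 0<i , λ t 0<t t≤ai →
        subst (0# <_) (solve 4 (λ a b c t → (a :+ :- (t :* c)) :+ t :* (c :+ b) := a :+ t :* b) refl a b c t)
          (0≤x⇒0<x+y (0≤a-tc t t≤ai) (*-pos 0<t 0<c+b))
      where
      aic≡a : (a * i) * c ≡ a
      aic≡a = trans (solve 3 (λ a i c → (a :* i) :* c := a :* (c :* i)) refl a i c)
                    (trans (cong (a *_) ci≡1) (*-identityʳ a))
      0≤a-tc : ∀ t → t ≤ a * i → 0# ≤ a + - (t * c)
      0≤a-tc t (inj₁ t<ai) = inj₁ (subst (0# <_)
        (trans (solve 3 (λ e t c → (e :+ :- t) :* c := e :* c :+ :- (t :* c)) refl (a * i) t c)
               (cong (_+ - (t * c)) aic≡a))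
        (*-pos (x<y⇒0<y-x t<ai) 0<c))
      0≤a-tc t (inj₂ refl) = inj₂ (trans (sym (-‿inverseʳ a)) (cong (λ z → a + - z) (sym aic≡a)))

    small-perturbation : ∀ a b →
      Small (λ t → a ≢ 0# → (a + t * b ≢ 0#) × (pos (a + t * b) ≡ pos a))
    small-perturbation a b = by-sign (compare 0# a)
      where
      by-sign : Tri (0# < a) (0# ≡ a) (a < 0#) →
                Small (λ t → a ≢ 0# → (a + t * b ≢ 0#) × (pos (a + t * b) ≡ pos a))
      by-sign (tri≈ _ 0≡a _) = 1# , 0<1 , λ _ _ _ a≢0 → contradiction (sym 0≡a) a≢0
      by-sign (tri< 0<a _ _) with small-pos b 0<a
      ... | ε , 0<ε , h = ε , 0<ε , λ t 0<t t≤ε _ →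
        ≢-sym (<⇒≢ (h t 0<t t≤ε)) , trans (0<x⇒pos (h t 0<t t≤ε)) (sym (0<x⇒pos 0<a))
      by-sign (tri> _ _ a<0) with small-pos (- b) (0<-x a<0)
      ... | ε , 0<ε , h = ε , 0<ε , λ t 0<t t≤ε _ →
        <⇒≢ (negative t 0<t t≤ε) , trans (x<0⇒¬pos (negative t 0<t t≤ε)) (sym (x<0⇒¬pos a<0))
        where
        negative : ∀ t → 0# < t → t ≤ ε → a + t * b < 0#
        negative t 0<t t≤ε = 0<-x⇒x<0 (subst (0# <_)
          (solve 3 (λ a b t → :- a :+ t :* :- b := :- (a :+ t :* b)) refl a b t) (h t 0<t t≤ε))

  pos-scale : ∀ {t x} → 0# < t → x ≢ 0# → (t * x ≢ 0#) × (pos (t * x) ≡ pos x)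
  pos-scale {t} {x} 0<t x≢0 with compare 0# x
  ... | tri< 0<x _ _ = ≢-sym (<⇒≢ (*-pos 0<t 0<x)) , 0<x⇒pos (*-pos 0<t 0<x)
  ... | tri≈ _ 0≡x _ = contradiction (sym 0≡x) x≢0
  ... | tri> _ _ x<0 = <⇒≢ tx<0 , x<0⇒¬pos tx<0
    where
    tx<0 : t * x < 0#
    tx<0 = 0<-x⇒x<0 (subst (0# <_) (solve 2 (λ t x → t :* :- x := :- (t :* x)) refl t x)
             (*-pos 0<t (0<-x x<0)))

-- Linear forms, perturbation, and strict linear inequalities.

module LinearForms (ℝ : RealModel) where
  open RealModel ℝ
  open OrderedField ℝ
  open Arr ℝ

  -- Applied to vectors and to forms alike.
  shift : ∀ {ℓ} → Vect ℓ → Carrier → Vect ℓ → Vect ℓ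
  shift v t w j = v j + t * w j

  zeroV : ∀ {ℓ} → Vect ℓ
  zeroV _ = 0#

  basis : ∀ {ℓ} → Fin ℓ → Vect ℓ
  basis zero    zero    = 1#
  basis zero    (suc _) = 0#
  basis (suc _) zero    = 0#
  basis (suc r) (suc j) = basis r j

  ev-zeroʳ : ∀ {ℓ} (a : Form ℓ) → ev a zeroV ≡ 0#
  ev-zeroʳ {zero}  a = refl
  ev-zeroʳ {suc ℓ} a = trans (+-congˡ (ev-zeroʳ (a ∘ suc)))
    (solve 1 (λ x → x :* con (+ 0) :+ con (+ 0) := con (+ 0)) refl (a zero))

  ev-zeroˡ : ∀ {ℓ} (a : Form ℓ) (v : Vect ℓ) → (∀ j → a j ≡ 0#) → ev a v ≡ 0#
  ev-zeroˡ {zero}  a v a≡0 = refl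
  ev-zeroˡ {suc ℓ} a v a≡0 = trans
    (cong₂ (λ x y → x * v zero + y) (a≡0 zero) (ev-zeroˡ (a ∘ suc) (v ∘ suc) (a≡0 ∘ suc)))
    (solve 1 (λ x → con (+ 0) :* x :+ con (+ 0) := con (+ 0)) refl (v zero))

  ev-cong : ∀ {ℓ} (a : Form ℓ) {v w : Vect ℓ} → (∀ j → v j ≡ w j) → ev a v ≡ ev a w
  ev-cong {zero}  a v≗w = refl
  ev-cong {suc ℓ} a v≗w = cong₂ (λ x y → a zero * x + y) (v≗w zero) (ev-cong (a ∘ suc) (v≗w ∘ suc))

  ev-basis : ∀ {ℓ} (a : Form ℓ) r → ev a (basis r) ≡ a r
  ev-basis a zero = trans (+-congˡ (ev-zeroʳ (a ∘ suc)))
    (solve 1 (λ x → x :* con (+ 1) :+ con (+ 0) := x) refl (a zero))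
  ev-basis a (suc r) = trans (+-congˡ (ev-basis (a ∘ suc) r))
    (solve 2 (λ x y → x :* con (+ 0) :+ y := y) refl (a zero) (a (suc r)))

  ev-shiftʳ : ∀ {ℓ} (a : Form ℓ) v t w → ev a (shift v t w) ≡ ev a v + t * ev a w
  ev-shiftʳ {zero}  a v t w = solve 1 (λ t → con (+ 0) := con (+ 0) :+ t :* con (+ 0)) refl t
  ev-shiftʳ {suc ℓ} a v t w = trans (+-congˡ (ev-shiftʳ (a ∘ suc) (v ∘ suc) t (w ∘ suc)))
    (solve 6 (λ a v w t V W → a :* (v :+ t :* w) :+ (V :+ t :* W)
                           := (a :* v :+ V) :+ t :* (a :* w :+ W)) refl
      (a zero) (v zero) (w zero) t _ _)

  ev-shiftˡ : ∀ {ℓ} (a : Form ℓ) t b v → ev (shift a t b) v ≡ ev a v + t * ev b v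
  ev-shiftˡ {zero}  a t b v = solve 1 (λ t → con (+ 0) := con (+ 0) :+ t :* con (+ 0)) refl t
  ev-shiftˡ {suc ℓ} a t b v = trans (+-congˡ (ev-shiftˡ (a ∘ suc) t (b ∘ suc) (v ∘ suc)))
    (solve 6 (λ a b v t V W → (a :+ t :* b) :* v :+ (V :+ t :* W)
                           := (a :* v :+ V) :+ t :* (b :* v :+ W)) refl
      (a zero) (b zero) (v zero) t _ _)

  ev-scaleʳ : ∀ {ℓ} (a : Form ℓ) t w → ev a (shift zeroV t w) ≡ t * ev a w
  ev-scaleʳ a t w = trans (ev-shiftʳ a zeroV t w) (trans (+-congʳ (ev-zeroʳ a)) (+-identityˡ _))

  ev-scaleˡ : ∀ {ℓ} t (a : Form ℓ) v → ev (shift zeroV t a) v ≡ t * ev a v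
  ev-scaleˡ t a v = trans (ev-shiftˡ zeroV t a v)
    (trans (+-congʳ (ev-zeroˡ zeroV v (λ _ → refl))) (+-identityˡ _))

  kernel-shift : ∀ {ℓ} (a : Form ℓ) v t w → ev a v ≡ 0# → ev a w ≡ 0# → ev a (shift v t w) ≡ 0#
  kernel-shift a v t w v≡0 w≡0 = trans (ev-shiftʳ a v t w)
    (trans (cong₂ (λ x y → x + t * y) v≡0 w≡0)
      (solve 1 (λ t → con (+ 0) :+ t :* con (+ 0) := con (+ 0)) refl t))

  abstract
    -- A nonzero coefficient `a r` makes `basis r` divided by `a r` a vector of value 1, which is
    -- the normalisation that `Projection` expects.
    unit-value? : ∀ {ℓ} (a : Form ℓ) → (Σ[ u ∈ Vect ℓ ] ev a u ≡ 1#) ⊎ (∀ v → ev a v ≡ 0#)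
    unit-value? a with any? (λ r → ¬? (a r ≟ 0#))
    ... | yes (r , ar≢0) = inj₁ (shift zeroV (proj₁ (inverse (a r) ar≢0)) (basis r) ,
            trans (ev-scaleʳ a _ (basis r)) (trans (*-congˡ (ev-basis a r))
              (trans (*-comm _ (a r)) (proj₂ (inverse (a r) ar≢0)))))
    ... | no ∄r = inj₂ λ v → ev-zeroˡ a v λ r → decidable-stable (a r ≟ 0#) λ ar≢0 → ∄r (r , ar≢0)

  1≢0 : 1# ≢ 0#
  1≢0 = ≢-sym 0≢1

  module Projection {ℓ} (a : Form ℓ) (u : Vect ℓ) (au≡1 : ev a u ≡ 1#) where

    project : Vect ℓ → Vect ℓ
    project v = shift v (- ev a v) u

    -- The transpose of `project`, the projection onto the kernel of `a` along `u`. Questions about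
    -- forms on that kernel become questions about forms on the whole space, so no basis of the
    -- kernel has to be chosen.
    restrict : Form ℓ → Form ℓ
    restrict b = shift b (- ev b u) a

    project-kernel : ∀ v → ev a (project v) ≡ 0#
    project-kernel v = trans (ev-shiftʳ a v _ u) (trans (cong (λ z → ev a v + - ev a v * z) au≡1)
      (solve 1 (λ x → x :+ :- x :* con (+ 1) := con (+ 0)) refl (ev a v)))

    ev-restrict : ∀ b v → ev (restrict b) v ≡ ev b (project v)
    ev-restrict b v = trans (ev-shiftˡ b _ a v) (trans
      (solve 3 (λ x y z → x :+ :- y :* z := x :+ :- z :* y) refl (ev b v) (ev b u) (ev a v))
      (sym (ev-shiftʳ b v _ u)))

    ev-restrict-kernel : ∀ b v → ev a v ≡ 0# → ev (restrict b) v ≡ ev b v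
    ev-restrict-kernel b v av≡0 = trans (ev-shiftˡ b _ a v) (trans (cong (λ z → ev b v + - ev b u * z) av≡0)
      (solve 2 (λ x y → x :+ :- y :* con (+ 0) := x) refl (ev b v) (ev b u)))

    ev-project-kernel : ∀ b v → ev b u ≡ 0# → ev b (project v) ≡ ev b v
    ev-project-kernel b v bu≡0 = trans (ev-shiftʳ b v _ u) (trans (cong (λ z → ev b v + - ev a v * z) bu≡0)
      (solve 2 (λ x y → x :+ :- y :* con (+ 0) := x) refl (ev b v) (ev a v)))

  abstract
    -- A nonzero value at `v` keeps its sign for small `t`, and finitely many thresholds have a
    -- common lower bound. Where `v` gives zero, the new value is `t` times the value at `w`, so any
    -- positive `t` will do.
    perturb : ∀ {ℓ n} (β : Fin n → Form ℓ) v w → Σ[ t ∈ Carrier ] (0# < t) × (∀ k →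
      (ev (β k) v ≢ 0# → (ev (β k) (shift v t w) ≢ 0#) × (pos (ev (β k) (shift v t w)) ≡ pos (ev (β k) v)))
      × (ev (β k) v ≡ 0# → ev (β k) w ≢ 0# →
         (ev (β k) (shift v t w) ≢ 0#) × (pos (ev (β k) (shift v t w)) ≡ pos (ev (β k) w))))
    perturb {n = n} β v w with small-all n (λ k → small-perturbation (ev (β k) v) (ev (β k) w))
    ... | t , 0<t , h = t , 0<t , λ k →
        (λ v≢0 → subst (λ z → (z ≢ 0#) × (pos z ≡ pos (ev (β k) v))) (sym (ev-shiftʳ (β k) v t w))
                   (h t 0<t (inj₂ refl) k v≢0))
      , (λ v≡0 w≢0 → subst (λ z → (z ≢ 0#) × (pos z ≡ pos (ev (β k) w)))
           (sym (trans (ev-shiftʳ (β k) v t w) (trans (+-congʳ v≡0) (+-identityˡ _))))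
           (pos-scale 0<t w≢0))

    -- A subspace is not covered by finitely many proper subspaces: when the next form vanishes at
    -- the vector found so far, a small shift towards a `w` with nonzero value repairs this and
    -- spoils no earlier form. `Q` marks the forms that are allowed to vanish.
    generic-vector : ∀ {ℓ} (X : Vect ℓ → Set) → X zeroV → (∀ v t w → X v → X w → X (shift v t w)) →
      ∀ n (β : Fin n → Form ℓ) (Q : Fin n → Set) →
      (∀ k → Q k ⊎ (Σ[ w ∈ Vect ℓ ] X w × (ev (β k) w ≢ 0#))) →
      Σ[ v ∈ Vect ℓ ] X v × (∀ k → Q k ⊎ (ev (β k) v ≢ 0#))
    generic-vector X X0 X+ zero β Q H = zeroV , X0 , λ ()
    generic-vector X X0 X+ (suc n) β Q H
      with H zero | generic-vector X X0 X+ n (β ∘ suc) (Q ∘ suc) (H ∘ suc)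
    ... | inj₁ q | v , Xv , h = v , Xv , λ { zero → inj₁ q ; (suc k) → h k }
    ... | inj₂ (w , Xw , w≢0) | v , Xv , h with ev (β zero) v ≟ 0#
    ... | no  v≢0 = v , Xv , λ { zero → inj₂ v≢0 ; (suc k) → h k }
    ... | yes v≡0 with perturb β v w
    ... | t , _ , p = shift v t w , X+ v t w Xv Xw , λ where
        zero    → inj₂ (proj₁ (proj₂ (p zero) v≡0 w≢0))
        (suc k) → map₂ (λ v≢0 → proj₁ (proj₁ (p (suc k)) v≢0)) (h k)

  -- Induction on the number of inequalities: a solution v₀ of all but the first
  -- either solves the first, or the segment from v₀ to any solution of the whole system
  -- meets the kernel of the first form; in the latter case it suffices to solve the
  -- remaining inequalities on that kernel and to push the solution off it.
  abstract
    solvable? : ∀ {ℓ} n (β : Fin n → Form ℓ) → Dec (Σ[ v ∈ Vect ℓ ] (∀ i → 0# < ev (β i) v))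
    solvable? zero β = yes (zeroV , λ ())
    solvable? {ℓ} (suc n) β with solvable? n (β ∘ suc)
    ... | no ¬s = no λ (v , h) → ¬s (v , h ∘ suc)
    ... | yes (v₀ , h₀) = split (0# <? ev (β zero) v₀) (unit-value? (β zero))
      where
      open IsStrictTotalOrder isStrictTotalOrder using (_<?_)
      split : Dec (0# < ev (β zero) v₀) → (Σ[ u ∈ Vect _ ] ev (β zero) u ≡ 1#) ⊎ (∀ v → ev (β zero) v ≡ 0#) →
              Dec (Σ[ v ∈ Vect _ ] (∀ i → 0# < ev (β i) v))
      split (yes p) _ = yes (v₀ , λ { zero → p ; (suc i) → h₀ i })
      split (no _) (inj₂ β≡0) = no λ (v , h) → <⇒≢ (h zero) (sym (β≡0 v))
      split (no 0≮) (inj₁ (u , βu≡1)) = mapDec push-off cut (solvable? n (restrict ∘ β ∘ suc))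
        where
        open Projection (β zero) u βu≡1
        push-off : Σ[ v ∈ Vect _ ] (∀ i → 0# < ev (restrict (β (suc i))) v) →
                   Σ[ v ∈ Vect _ ] (∀ i → 0# < ev (β i) v)
        push-off (v , h) with perturb β (project v) u
        ... | t , _ , p = shift (project v) t u , λ where
            zero → pos⇒0<x (trans
              (proj₂ (proj₂ (p zero) (project-kernel v) (subst (_≢ 0#) (sym βu≡1) 1≢0)))
              (trans (cong pos βu≡1) (0<x⇒pos 0<1)))
            (suc i) → let 0<βv = subst (0# <_) (ev-restrict (β (suc i)) v) (h i) in
              pos⇒0<x (trans (proj₂ (proj₁ (p (suc i)) (≢-sym (<⇒≢ 0<βv)))) (0<x⇒pos 0<βv))
        cut : Σ[ v ∈ Vect _ ] (∀ i → 0# < ev (β i) v) →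
              Σ[ v ∈ Vect _ ] (∀ i → 0# < ev (restrict (β (suc i))) v)
        cut (v , h) = w , λ i → subst (0# <_)
            (sym (trans (ev-restrict-kernel (β (suc i)) w w-kernel) (ev-w (β (suc i)))))
            (0≤x⇒0<x+y (0≤xy 0≤a (h (suc i))) (*-pos (h zero) (h₀ i)))
          where
          -- These weights make `w` a positive multiple of the point where the segment from `v₀` to
          -- `v` meets the kernel. Only signs matter, so the division is omitted.
          a b : Carrier
          a = - ev (β zero) v₀
          b = ev (β zero) v
          w : Vect ℓ
          w = shift (shift zeroV a v) b v₀
          ev-w : ∀ γ → ev γ w ≡ a * ev γ v + b * ev γ v₀
          ev-w γ = trans (ev-shiftʳ γ _ b v₀) (+-congʳ (ev-scaleʳ γ a v))
          w-kernel : ev (β zero) w ≡ 0#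
          w-kernel = trans (ev-w (β zero))
            (solve 2 (λ x y → :- x :* y :+ y :* x := con (+ 0)) refl (ev (β zero) v₀) b)
          0≤a : 0# ≤ a
          0≤a with ≮⇒≥ 0≮
          ... | inj₁ p = inj₁ (0<-x p)
          ... | inj₂ p = inj₂ (trans (solve 0 (con (+ 0) := :- con (+ 0)) refl) (cong -_ (sym p)))

-- Topology: open half-spaces and connectedness of convex sets.

module Chambers (ℝ : RealModel) where
  open RealModel ℝ
  open OrderedField ℝ
  open LinearForms ℝ
  open Arr ℝ

  Box : ∀ {ℓ} → Carrier → Vect ℓ → Vect ℓ → Set
  Box ε x y = ∀ j → (x j + - ε < y j) × (y j < x j + ε)

  x-ε<x : ∀ {x ε} → 0# < ε → x + - ε < x
  x-ε<x {x} {ε} 0<ε = 0<y-x⇒x<y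
    (subst (0# <_) (solve 2 (λ x e → e := x :+ :- (x :+ :- e)) refl x ε) 0<ε)

  x<x+ε : ∀ {x ε} → 0# < ε → x < x + ε
  x<x+ε {x} {ε} 0<ε = 0<y-x⇒x<y
    (subst (0# <_) (solve 2 (λ x e → e := (x :+ e) :+ :- x) refl x ε) 0<ε)

  -- A predicate on vectors need not respect pointwise equality, but an open one does: a pointwise
  -- equal vector lies in every box around the given one.
  open-respects-≗ : ∀ {ℓ} {U : Vect ℓ → Set} → IsOpen U → ∀ {x y} → (∀ j → x j ≡ y j) → U x → U y
  open-respects-≗ oU {x} {y} x≗y Ux with oU x Ux
  ... | ε , 0<ε , h = h y λ j →
    subst (x j + - ε <_) (x≗y j) (x-ε<x 0<ε) , subst (_< x j + ε) (x≗y j) (x<x+ε 0<ε)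

  abstract
    -- To the right and to the left of `x` this is `small-pos` with slope `a` and `- a`, the
    -- distance from `y` to `x` being the small parameter. A lower bound is all that open
    -- half-spaces require.
    mul-lower-semicontinuous : ∀ a x {η} → 0# < η → Σ[ ε ∈ Carrier ] (0# < ε) ×
      (∀ y → (x + - ε < y) × (y < x + ε) → 0# < η + (a * y + - (a * x)))
    mul-lower-semicontinuous a x {η} 0<η with small-pos a 0<η | small-pos (- a) 0<η
    ... | ε₁ , 0<ε₁ , h₁ | ε₂ , 0<ε₂ , h₂ with lower-bound 0<ε₁ 0<ε₂
    ... | ε , 0<ε , ε≤ε₁ , ε≤ε₂ = ε , 0<ε , bound
      where
      bound : ∀ y → (x + - ε < y) × (y < x + ε) → 0# < η + (a * y + - (a * x))
      bound y (x-ε<y , y<x+ε) with compare x y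
      ... | tri< x<y _ _ = subst (0# <_)
        (solve 4 (λ a x y e → e :+ (y :+ :- x) :* a := e :+ (a :* y :+ :- (a :* x))) refl a x y η)
        (h₁ (y + - x) (x<y⇒0<y-x x<y) (≤-trans (inj₁ (0<y-x⇒x<y (subst (0# <_)
          (solve 3 (λ x y e → (x :+ e) :+ :- y := e :+ :- (y :+ :- x)) refl x y ε)
          (x<y⇒0<y-x y<x+ε)))) ε≤ε₁))
      ... | tri≈ _ refl _ = subst (0# <_)
        (solve 3 (λ a x e → e := e :+ (a :* x :+ :- (a :* x))) refl a x η) 0<η
      ... | tri> _ _ y<x = subst (0# <_)
        (solve 4 (λ a x y e → e :+ (x :+ :- y) :* :- a := e :+ (a :* y :+ :- (a :* x))) refl a x y η)
        (h₂ (x + - y) (x<y⇒0<y-x y<x) (≤-trans (inj₁ (0<y-x⇒x<y (subst (0# <_)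
          (solve 3 (λ x y e → y :+ :- (x :+ :- e) := e :+ :- (x :+ :- y)) refl x y ε)
          (x<y⇒0<y-x x-ε<y)))) ε≤ε₂))

    ev-lower-semicontinuous : ∀ {ℓ} (a : Form ℓ) x {η} → 0# < η → Σ[ ε ∈ Carrier ] (0# < ε) ×
      (∀ y → Box ε x y → 0# < η + (ev a y + - ev a x))
    ev-lower-semicontinuous {zero} a x {η} 0<η = 1# , 0<1 , λ y _ →
      subst (0# <_) (solve 1 (λ e → e := e :+ (con (+ 0) :+ :- con (+ 0))) refl η) 0<η
    -- Half of the margin is spent on the first coordinate and half on the others.
    ev-lower-semicontinuous {suc ℓ} a x {η} 0<η with half 0<η
    ... | h , 0<h , h+h≡η with mul-lower-semicontinuous (a zero) (x zero) 0<h
                             | ev-lower-semicontinuous (a ∘ suc) (x ∘ suc) 0<h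
    ... | ε₁ , 0<ε₁ , h₁ | ε₂ , 0<ε₂ , h₂ with lower-bound 0<ε₁ 0<ε₂
    ... | ε , 0<ε , ε≤ε₁ , ε≤ε₂ = ε , 0<ε , λ y box → subst (0# <_)
        (trans (solve 5 (λ h s t s' t' → (h :+ (s :+ :- t)) :+ (h :+ (s' :+ :- t'))
                  := (h :+ h) :+ ((s :+ s') :+ :- (t :+ t'))) refl h
                (a zero * y zero) (a zero * x zero) (ev (a ∘ suc) (y ∘ suc)) (ev (a ∘ suc) (x ∘ suc)))
               (+-congʳ h+h≡η))
        (0<x+y (h₁ (y zero) (shrink ε≤ε₁ (box zero))) (h₂ (y ∘ suc) λ j → shrink ε≤ε₂ (box (suc j))))
      where
      shrink : ∀ {ε ε′ x y} → ε ≤ ε′ → (x + - ε < y) × (y < x + ε) → (x + - ε′ < y) × (y < x + ε′)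
      shrink (inj₂ refl) p = p
      shrink {ε} {ε′} {x} {y} (inj₁ ε<ε′) (l , u) =
          <-trans (0<y-x⇒x<y (subst (0# <_)
            (solve 3 (λ x e f → f :+ :- e := (x :+ :- e) :+ :- (x :+ :- f)) refl x ε ε′) 0<δ)) l
        , <-trans u (0<y-x⇒x<y (subst (0# <_)
            (solve 3 (λ x e f → f :+ :- e := (x :+ f) :+ :- (x :+ e)) refl x ε ε′) 0<δ))
        where
        0<δ : 0# < ε′ + - ε
        0<δ = x<y⇒0<y-x ε<ε′

  HalfSpace : ∀ {ℓ} → Form ℓ → Vect ℓ → Set
  HalfSpace a x = 0# < ev a x

  abstract
    -- The margin in the semicontinuity estimate is the value `ev a x` itself, which then cancels
    -- and leaves `ev a y`.
    halfSpace-open : ∀ {ℓ} (a : Form ℓ) → IsOpen (HalfSpace a)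
    halfSpace-open a x 0<ax with ev-lower-semicontinuous a x 0<ax
    ... | ε , 0<ε , h = ε , 0<ε , λ y box →
      subst (0# <_) (solve 2 (λ s t → s :+ (t :+ :- s) := t) refl (ev a x) (ev a y)) (h y box)

    -- Otherwise the open half-spaces of `a` and of its negative would disconnect `S`.
    connected-same-side : ∀ {ℓ} {S : Vect ℓ → Set} (a : Form ℓ) → IsConnected S →
      (∀ x → S x → ev a x ≢ 0#) → ∀ {x y} → S x → S y → 0# < ev a x → ¬ (ev a y < 0#)
    connected-same-side {ℓ} {S} a conn S≢0 {x} {y} Sx Sy 0<ax ay<0 =
      conn (HalfSpace a , HalfSpace b , halfSpace-open a , halfSpace-open b , cover ,
            (λ z _ 0<az 0<bz → <-irrefl (<-trans 0<az (b⇒ 0<bz))) , (x , Sx , 0<ax) , (y , Sy , ⇒b ay<0))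
      where
      b : Form ℓ
      b = shift zeroV (- 1#) a
      bz≡-az : ∀ z → ev b z ≡ - ev a z
      bz≡-az z = trans (ev-scaleˡ (- 1#) a z) (solve 1 (λ x → :- con (+ 1) :* x := :- x) refl (ev a z))
      b⇒ : ∀ {z} → 0# < ev b z → ev a z < 0#
      b⇒ {z} p = 0<-x⇒x<0 (subst (0# <_) (bz≡-az z) p)
      ⇒b : ∀ {z} → ev a z < 0# → 0# < ev b z
      ⇒b {z} p = subst (0# <_) (sym (bz≡-az z)) (0<-x p)
      cover : ∀ z → S z → HalfSpace a z ⊎ HalfSpace b z
      cover z Sz with compare 0# (ev a z)
      ... | tri< p _ _ = inj₁ p
      ... | tri≈ _ p _ = contradiction (sym p) (S≢0 z Sz)
      ... | tri> _ _ p = inj₂ (⇒b p)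

    -- Both directions matter for the supremum argument: moving forward contradicts that it is an
    -- upper bound, moving backward that it is the least one.
    open-along-line : ∀ {ℓ} {V : Vect ℓ → Set} → IsOpen V → ∀ x d s → V (shift x s d) →
      Σ[ δ ∈ Carrier ] (0# < δ) ×
      (∀ t → 0# < t → t ≤ δ → V (shift x (s + t) d) × V (shift x (s + - t) d))
    open-along-line {ℓ} {V} oV x d s Vcs with oV (shift x s d) Vcs
    ... | ε , 0<ε , h with small-all ℓ (λ j → small-pos (d j) 0<ε) | small-all ℓ (λ j → small-pos (- d j) 0<ε)
    ... | δ₁ , 0<δ₁ , h₁ | δ₂ , 0<δ₂ , h₂ with lower-bound 0<δ₁ 0<δ₂
    ... | δ , 0<δ , δ≤δ₁ , δ≤δ₂ = δ , 0<δ , λ t 0<t t≤δ →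
        h (shift x (s + t) d) (forward t (h₁ t 0<t (≤-trans t≤δ δ≤δ₁)) (h₂ t 0<t (≤-trans t≤δ δ≤δ₂)))
      , h (shift x (s + - t) d) (backward t (h₁ t 0<t (≤-trans t≤δ δ≤δ₁)) (h₂ t 0<t (≤-trans t≤δ δ≤δ₂)))
      where
      forward : ∀ t → (∀ j → 0# < ε + t * d j) → (∀ j → 0# < ε + t * - d j) →
                Box ε (shift x s d) (shift x (s + t) d)
      forward t p q j =
          0<y-x⇒x<y (subst (0# <_) (solve 5 (λ x s t d e →
            e :+ t :* d := (x :+ (s :+ t) :* d) :+ :- ((x :+ s :* d) :+ :- e)) refl (x j) s t (d j) ε) (p j))
        , 0<y-x⇒x<y (subst (0# <_) (solve 5 (λ x s t d e →
            e :+ t :* :- d := ((x :+ s :* d) :+ e) :+ :- (x :+ (s :+ t) :* d)) refl (x j) s t (d j) ε) (q j))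
      backward : ∀ t → (∀ j → 0# < ε + t * d j) → (∀ j → 0# < ε + t * - d j) →
                 Box ε (shift x s d) (shift x (s + - t) d)
      backward t p q j =
          0<y-x⇒x<y (subst (0# <_) (solve 5 (λ x s t d e →
            e :+ t :* :- d := (x :+ (s :+ :- t) :* d) :+ :- ((x :+ s :* d) :+ :- e)) refl (x j) s t (d j) ε) (q j))
        , 0<y-x⇒x<y (subst (0# <_) (solve 5 (λ x s t d e →
            e :+ t :* d := ((x :+ s :* d) :+ e) :+ :- (x :+ (s :+ :- t) :* d)) refl (x j) s t (d j) ε) (p j))

  segment : ∀ {ℓ} → Vect ℓ → Vect ℓ → Carrier → Vect ℓ
  segment x y t = shift x t (shift y (- 1#) x)

  abstract
    cone-convex : ∀ {ℓ n} (β : Fin n → Form ℓ) x y → (∀ k → 0# < ev (β k) x) → (∀ k → 0# < ev (β k) y) →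
      ∀ t → 0# ≤ t → t ≤ 1# → ∀ k → 0# < ev (β k) (segment x y t)
    cone-convex β x y βx>0 βy>0 t 0≤t t≤1 k = subst (0# <_) (sym value) (positive-combination t≤1)
      where
      a b : Carrier
      a = ev (β k) x
      b = ev (β k) y
      value : ev (β k) (segment x y t) ≡ t * b + (1# + - t) * a
      value = trans (ev-shiftʳ (β k) x t (shift y (- 1#) x))
        (trans (cong (λ z → a + t * z) (ev-shiftʳ (β k) y (- 1#) x))
          (solve 3 (λ t a b → a :+ t :* (b :+ :- con (+ 1) :* a)
                           := t :* b :+ (con (+ 1) :+ :- t) :* a) refl t a b))
      positive-combination : t ≤ 1# → 0# < t * b + (1# + - t) * a
      positive-combination (inj₁ t<1) = 0≤x⇒0<x+y (0≤xy 0≤t (βy>0 k)) (*-pos (x<y⇒0<y-x t<1) (βx>0 k))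
      positive-combination (inj₂ t≡1) = subst (λ t → 0# < t * b + (1# + - t) * a) (sym t≡1) (subst (0# <_)
        (solve 2 (λ a b → b := con (+ 1) :* b :+ (con (+ 1) :+ :- con (+ 1)) :* a) refl a b) (βy>0 k))

    segment-start : ∀ {ℓ} (x y : Vect ℓ) j → x j ≡ segment x y 0# j
    segment-start x y j = solve 2 (λ x y → x := x :+ con (+ 0) :* (y :+ :- con (+ 1) :* x)) refl (x j) (y j)

    segment-end : ∀ {ℓ} (x y : Vect ℓ) j → y j ≡ segment x y 1# j
    segment-end x y j = solve 2 (λ x y → y := x :+ con (+ 1) :* (y :+ :- con (+ 1) :* x)) refl (x j) (y j)

  -- The supremum of the parameters whose point on the segment [x, y] lies in U
  -- can be neither in U nor in W.
  convex-connected : ∀ {ℓ} (S : Vect ℓ → Set) →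
    (∀ x y → S x → S y → ∀ t → 0# ≤ t → t ≤ 1# → S (segment x y t)) → IsConnected S
  convex-connected S convex (U , W , oU , oW , cover , disjoint , (x , Sx , Ux) , (y , Sy , Wy)) =
    at-supremum (complete P (0# , P0) (1# , λ t p → proj₁ (proj₂ p)))
    where
    c : Carrier → Vect _
    c = segment x y

    P : Carrier → Set
    P t = (0# ≤ t) × (t ≤ 1#) × U (c t)

    P0 : P 0#
    P0 = inj₂ refl , inj₁ 0<1 , open-respects-≗ oU (segment-start x y) Ux

    Wc1 : W (c 1#)
    Wc1 = open-respects-≗ oW (segment-end x y) Wy

    U∩W : ∀ {t} → 0# ≤ t → t ≤ 1# → U (c t) → W (c t) → ⊥
    U∩W {t} 0≤t t≤1 = disjoint (c t) (convex x y Sx Sy t 0≤t t≤1)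

    at-supremum : (Σ[ s ∈ Carrier ] ((∀ t → P t → t ≤ s) × (∀ b → (∀ t → P t → t ≤ b) → s ≤ b))) → ⊥
    at-supremum (s , upper , least) = [ sup∉U s≤1 , sup∉W ]′ (cover (c s) (convex x y Sx Sy s 0≤s s≤1))
      where
      0≤s : 0# ≤ s
      0≤s = upper 0# P0
      s≤1 : s ≤ 1#
      s≤1 = least 1# λ t p → proj₁ (proj₂ p)

      sup∉U : s ≤ 1# → ¬ U (c s)
      sup∉U (inj₂ s≡1) Ucs = U∩W 0≤s s≤1 Ucs (subst (λ t → W (c t)) (sym s≡1) Wc1)
      sup∉U (inj₁ s<1) Ucs with open-along-line oU x (shift y (- 1#) x) s Ucs
      ... | δ , 0<δ , h with lower-bound 0<δ (x<y⇒0<y-x s<1)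
      ... | t , 0<t , t≤δ , t≤1-s = ≤⇒≯ (upper (s + t)
          (≤-trans 0≤s (inj₁ (x<x+ε 0<t)) , s+t≤1 t≤1-s , proj₁ (h t 0<t t≤δ))) (x<x+ε 0<t)
        where
        s+t≤1 : t ≤ 1# + - s → s + t ≤ 1#
        s+t≤1 (inj₁ p) = inj₁ (0<y-x⇒x<y (subst (0# <_)
          (solve 2 (λ s t → (con (+ 1) :+ :- s) :+ :- t := con (+ 1) :+ :- (s :+ t)) refl s t) (x<y⇒0<y-x p)))
        s+t≤1 (inj₂ p) = inj₂ (trans (+-congˡ p)
          (solve 1 (λ s → s :+ (con (+ 1) :+ :- s) := con (+ 1)) refl s))

      sup∉W : ¬ W (c s)
      sup∉W Wcs with open-along-line oW x (shift y (- 1#) x) s Wcs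
      ... | δ , 0<δ , h =
          -- The segment lies in `W` from parameter `s + - δ` up to `s`, so no parameter in `P`
          -- exceeds `s + - δ`, which would be a smaller upper bound.
          ≤⇒≯ (least (s + - δ) λ t Pt → ≮⇒≥ (λ s-δ<t → clash t Pt s-δ<t (upper t Pt))) (x-ε<x 0<δ)
        where
        clash : ∀ t → P t → s + - δ < t → t ≤ s → ⊥
        clash t (0≤t , t≤1 , Uct) _ (inj₂ t≡s) = U∩W 0≤t t≤1 Uct (subst (λ t → W (c t)) (sym t≡s) Wcs)
        clash t (0≤t , t≤1 , Uct) s-δ<t (inj₁ t<s) = U∩W 0≤t t≤1 Uct
          (subst (λ t → W (c t)) (solve 2 (λ s t → s :+ :- (s :+ :- t) := t) refl s t)
            (proj₂ (h (s + - t) (x<y⇒0<y-x t<s) (inj₁ (0<y-x⇒x<y (subst (0# <_)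
              (solve 3 (λ s t e → t :+ :- (s :+ :- e) := e :+ :- (s :+ :- t)) refl s t δ)
              (x<y⇒0<y-x s-δ<t)))))))

-- Chambers as sign patterns, and chambers near generic points.

module Patterns (ℝ : RealModel) where
  open RealModel ℝ
  open OrderedField ℝ
  open LinearForms ℝ
  open Chambers ℝ
  open Arr ℝ

  module _ {ℓ n : ℕ} (A : Arrangement ℓ n) where
    open Arrangement A

    pattern-of : Point A → Fin n → Bool
    pattern-of p k = pos (ev (α k) (proj₁ p))

    chamber⇒pattern : ∀ p q → SameChamber A p q → ∀ k → pattern-of p k ≡ pattern-of q k
    chamber⇒pattern p q (S , S⊆M , Sp , Sq , conn) k = same _ _ refl refl
      where
      same : ∀ s t → pattern-of p k ≡ s → pattern-of q k ≡ t → s ≡ t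
      same true  true  _  _  = refl
      same false false _  _  = refl
      same true  false ep eq = ⊥-elim (connected-same-side (α k) conn (λ x Sx → S⊆M x Sx k) Sp Sq
        (pos⇒0<x ep) (¬pos⇒x<0 (proj₂ q k) eq))
      same false true  ep eq = ⊥-elim (connected-same-side (α k) conn (λ x Sx → S⊆M x Sx k) Sq Sp
        (pos⇒0<x eq) (¬pos⇒x<0 (proj₂ p k) ep))

    oriented : (Fin n → Bool) → Fin n → Form ℓ
    oriented s k = shift zeroV (sign (s k)) (α k)

    -- The points with a given pattern form an intersection of open half-spaces, a convex and hence
    -- connected set inside the complement.
    pattern⇒chamber : ∀ p q → (∀ k → pattern-of p k ≡ pattern-of q k) → SameChamber A p q
    pattern⇒chamber p q p~q = S ,
        (λ x Sx k → proj₁ (0<sign*⇒ (s k) (subst (0# <_) (ev-scaleˡ _ (α k) x) (Sx k)))) ,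
        inCone p (λ _ → refl) , inCone q (λ k → sym (p~q k)) ,
        convex-connected S (cone-convex (oriented s))
      where
      s : Fin n → Bool
      s = pattern-of p
      S : Vect ℓ → Set
      S x = ∀ k → 0# < ev (oriented s k) x
      inCone : ∀ r → (∀ k → pattern-of r k ≡ s k) → S (proj₁ r)
      inCone r e k = subst (0# <_) (sym (ev-scaleˡ _ (α k) (proj₁ r))) (0<sign* (s k) (proj₂ r k) (e k))

    separates⇒≢ : ∀ i p q → Separates A i p q → pattern-of p i ≢ pattern-of q i
    separates⇒≢ i p q (inj₁ (0<p , q<0)) e with trans (sym (0<x⇒pos 0<p)) (trans e (x<0⇒¬pos q<0))
    ... | ()
    separates⇒≢ i p q (inj₂ (p<0 , 0<q)) e with trans (sym (x<0⇒¬pos p<0)) (trans e (0<x⇒pos 0<q))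
    ... | ()

    ≢⇒separates : ∀ i p q → pattern-of p i ≢ pattern-of q i → Separates A i p q
    ≢⇒separates i p q p≢q = sep _ _ refl refl
      where
      sep : ∀ s t → pattern-of p i ≡ s → pattern-of q i ≡ t → Separates A i p q
      sep true  true  ep eq = contradiction (trans ep (sym eq)) p≢q
      sep false false ep eq = contradiction (trans ep (sym eq)) p≢q
      sep true  false ep eq = inj₁ (pos⇒0<x ep , ¬pos⇒x<0 (proj₂ q i) eq)
      sep false true  ep eq = inj₂ (¬pos⇒x<0 (proj₂ p i) ep , pos⇒0<x eq)

    -- The composition of the covectors of `v` and `d`, in the sense of oriented matroids: the
    -- pattern of a point slightly off `v` in direction `d`.
    Near : Vect ℓ → Vect ℓ → Point A → Set
    Near v d p = ∀ k → (ev (α k) v ≢ 0# → pattern-of p k ≡ pos (ev (α k) v))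
                     × (ev (α k) v ≡ 0# → ev (α k) d ≢ 0# → pattern-of p k ≡ pos (ev (α k) d))

    abstract
      realizable? : ∀ (s : Fin n → Bool) → Dec (Σ[ p ∈ Point A ] (∀ k → pattern-of p k ≡ s k))
      realizable? s = mapDec to from (solvable? n (oriented s))
        where
        to : Σ[ v ∈ Vect ℓ ] (∀ k → 0# < ev (oriented s k) v) → Σ[ p ∈ Point A ] (∀ k → pattern-of p k ≡ s k)
        to (v , h) = (v , λ k → proj₁ (side k)) , λ k → proj₂ (side k)
          where
          side : ∀ k → (ev (α k) v ≢ 0#) × (pos (ev (α k) v) ≡ s k)
          side k = 0<sign*⇒ (s k) (subst (0# <_) (ev-scaleˡ _ (α k) v) (h k))
        from : Σ[ p ∈ Point A ] (∀ k → pattern-of p k ≡ s k) → Σ[ v ∈ Vect ℓ ] (∀ k → 0# < ev (oriented s k) v)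
        from ((v , v∈M) , e) = v , λ k → subst (0# <_) (sym (ev-scaleˡ _ (α k) v)) (0<sign* (s k) (v∈M k) (e k))

      point-near : ∀ (v d : Vect ℓ) → (∀ k → (ev (α k) v ≢ 0#) ⊎ ((ev (α k) v ≡ 0#) × (ev (α k) d ≢ 0#))) →
        Σ[ p ∈ Point A ] Near v d p
      point-near v d H with perturb α v d
      ... | t , _ , h = (shift v t d , λ k → [ (λ v≢0 → proj₁ (proj₁ (h k) v≢0))
                                             , (λ (v≡0 , d≢0) → proj₁ (proj₂ (h k) v≡0 d≢0)) ]′ (H k)) ,
        λ k → (λ v≢0 → proj₂ (proj₁ (h k) v≢0)) , (λ v≡0 d≢0 → proj₂ (proj₂ (h k) v≡0 d≢0))

      α≢0 : ∀ i → ¬ (∀ v → ev (α i) v ≡ 0#)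
      α≢0 i αi≡0 = nonzero i λ j → trans (sym (ev-basis (α i) j)) (αi≡0 (basis j))

      α-unit : ∀ i → Σ[ u ∈ Vect ℓ ] ev (α i) u ≡ 1#
      α-unit i = [ (λ u → u) , (λ αi≡0 → contradiction αi≡0 (α≢0 i)) ]′ (unit-value? (α i))

      nonproportional : ∀ {i k} → i ≢ k → ∀ c → ¬ (∀ v → ev (α k) v ≡ c * ev (α i) v)
      nonproportional {i} {k} i≢k c αk≡cαi = distinct i k i≢k λ v → i⇒k v , k⇒i v
        where
        i⇒k : ∀ v → ev (α i) v ≡ 0# → ev (α k) v ≡ 0#
        i⇒k v αi≡0 = trans (αk≡cαi v) (trans (cong (c *_) αi≡0) (zeroʳ c))
        c≢0 : c ≢ 0#
        c≢0 c≡0 = α≢0 k λ v → trans (αk≡cαi v) (trans (cong (_* ev (α i) v) c≡0) (zeroˡ (ev (α i) v)))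
        k⇒i : ∀ v → ev (α k) v ≡ 0# → ev (α i) v ≡ 0#
        k⇒i v αk≡0 with ev (α i) v ≟ 0#
        ... | yes αi≡0 = αi≡0
        ... | no  αi≢0 = contradiction (trans (sym (αk≡cαi v)) αk≡0) (product≢0 c≢0 αi≢0)

      -- If `α k` vanished on the kernel of `α i`, it would be `ev (α k) u` times `α i`, and the two
      -- hyperplanes would coincide. Used in both orders, this gives vectors dual to a pair of
      -- forms.
      independent : ∀ {i k} → i ≢ k → Σ[ w ∈ Vect ℓ ] (ev (α i) w ≡ 0#) × (ev (α k) w ≡ 1#)
      independent {i} {k} i≢k with α-unit i
      ... | u , αiu≡1 with unit-value? (Projection.restrict (α i) u αiu≡1 (α k))
      ... | inj₁ (w , e) = project w , project-kernel w , trans (sym (ev-restrict (α k) w)) e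
        where open Projection (α i) u αiu≡1
      ... | inj₂ vanish = ⊥-elim (nonproportional i≢k (ev (α k) u) proportional)
        where
        proportional : ∀ v → ev (α k) v ≡ ev (α k) u * ev (α i) v
        proportional v = trans
          (solve 3 (λ x c y → x := (x :+ :- c :* y) :+ c :* y) refl (ev (α k) v) (ev (α k) u) (ev (α i) v))
          (trans (cong (_+ ev (α k) u * ev (α i) v) (trans (sym (ev-shiftˡ (α k) (- ev (α k) u) (α i) v)) (vanish v)))
                 (+-identityˡ (ev (α k) u * ev (α i) v)))

      generic-vector-on-wall : ∀ i → Σ[ v ∈ Vect ℓ ] (ev (α i) v ≡ 0#) × (∀ k → (k ≡ i) ⊎ (ev (α k) v ≢ 0#))
      generic-vector-on-wall i =
        generic-vector (λ v → ev (α i) v ≡ 0#) (ev-zeroʳ (α i)) (kernel-shift (α i)) n α (_≡ i) off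
        where
        off : ∀ k → (k ≡ i) ⊎ (Σ[ w ∈ Vect ℓ ] (ev (α i) w ≡ 0#) × (ev (α k) w ≢ 0#))
        off k with k ≟ᶠ i
        ... | yes k≡i = inj₁ k≡i
        ... | no  k≢i with independent (≢-sym k≢i)
        ... | w , αi≡0 , αk≡1 = inj₂ (w , αi≡0 , subst (_≢ 0#) (sym αk≡1) 1≢0)

      -- A point of the i-th hyperplane on no other hyperplane is pushed off in the directions `u`
      -- and `- u`. Every hyperplane thus separates two chambers that no other hyperplane separates.
      wall : ∀ i → Σ[ p ∈ (Bool → Point A) ] ((∀ s → pattern-of (p s) i ≡ s)
               × (∀ k → k ≢ i → ∀ s t → pattern-of (p s) k ≡ pattern-of (p t) k))
      wall i with generic-vector-on-wall i | α-unit i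
      ... | v , αi≡0 , generic | u , αiu≡1 = (λ s → proj₁ (near s)) , on-wall , off-wall
        where
        d : Bool → Vect ℓ
        d s = shift zeroV (sign s) u
        αid : ∀ s → ev (α i) (d s) ≡ sign s
        αid s = trans (ev-scaleʳ (α i) (sign s) u) (trans (*-congˡ αiu≡1) (*-identityʳ (sign s)))
        αid≢0 : ∀ s → ev (α i) (d s) ≢ 0#
        αid≢0 s = subst (_≢ 0#) (sym (αid s)) (sign≢0 s)
        near : ∀ s → Σ[ p ∈ Point A ] Near v (d s) p
        near s = point-near v (d s) λ k →
          [ (λ { refl → inj₂ (αi≡0 , αid≢0 s) }) , inj₁ ]′ (generic k)
        on-wall : ∀ s → pattern-of (proj₁ (near s)) i ≡ s
        on-wall s = trans (proj₂ (proj₂ (near s) i) αi≡0 (αid≢0 s)) (trans (cong pos (αid s)) (pos-sign s))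
        off-wall : ∀ k → k ≢ i → ∀ s t → pattern-of (proj₁ (near s)) k ≡ pattern-of (proj₁ (near t)) k
        off-wall k k≢i s t with generic k
        ... | inj₁ k≡i = contradiction k≡i k≢i
        ... | inj₂ v≢0 = trans (proj₁ (proj₂ (near s) k) v≢0) (sym (proj₁ (proj₂ (near t) k) v≢0))

      -- Restricting `α k` to both kernels in turn decides whether it vanishes on the intersection.
      -- If it did, `i`, `j` and `k` would be three distinct hyperplanes through one codimension-2
      -- flat, where only two are allowed.
      generic⇒avoids : GenericCodim2 A → ∀ {i j} → i ≢ j → ∀ k → k ≢ i → k ≢ j →
        Σ[ v ∈ Vect ℓ ] ((ev (α i) v ≡ 0#) × (ev (α j) v ≡ 0#)) × (ev (α k) v ≢ 0#)
      generic⇒avoids G {i} {j} i≢j k k≢i k≢j with independent (≢-sym i≢j) | independent i≢j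
      ... | u , αju≡0 , αiu≡1 | w , αiw≡0 , αjw≡1 =
        [ found , (λ vanish → contradiction (contained vanish) not-contained) ]′
          (unit-value? (Pj.restrict (Pi.restrict (α k))))
        where
        module Pi = Projection (α i) u αiu≡1
        module Pj = Projection (α j) w αjw≡1
        X : Vect ℓ → Set
        X v = (ev (α i) v ≡ 0#) × (ev (α j) v ≡ 0#)
        found : Σ[ z ∈ Vect ℓ ] ev (Pj.restrict (Pi.restrict (α k))) z ≡ 1# →
          Σ[ v ∈ Vect ℓ ] ((ev (α i) v ≡ 0#) × (ev (α j) v ≡ 0#)) × (ev (α k) v ≢ 0#)
        -- The outer projection moves along `u`, on which `α j` vanishes, so it does not undo the
        -- inner one.
        found (z , e) = Pi.project (Pj.project z) ,
          (Pi.project-kernel (Pj.project z) ,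
           trans (Pi.ev-project-kernel (α j) (Pj.project z) αju≡0) (Pj.project-kernel z)) ,
          subst (_≢ 0#) (trans (sym e) (trans (Pj.ev-restrict _ z) (Pi.ev-restrict (α k) (Pj.project z)))) 1≢0
        contained : (∀ v → ev (Pj.restrict (Pi.restrict (α k))) v ≡ 0#) → ContainedIn A X k
        contained vanish v (αi≡0 , αj≡0) = trans (sym (Pi.ev-restrict-kernel (α k) v αi≡0))
          (trans (sym (Pj.ev-restrict-kernel (Pi.restrict (α k)) v αj≡0)) (vanish v))
        codim2 : IsCodim2 A X
        codim2 = α i , α j ,
          (λ l m e → coefficient l m e αiu≡1 αju≡0 ,
                     coefficient m l (λ r → trans (+-comm (m * α j r) (l * α i r)) (e r)) αjw≡1 αiw≡0) ,
          λ v → (λ z → z) , (λ z → z)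
          where
          -- Evaluating a linear relation at the vector dual to `a` isolates the coefficient of `a`.
          coefficient : ∀ {a b : Form ℓ} l m → (∀ r → l * a r + m * b r ≡ 0#) →
            ∀ {u} → ev a u ≡ 1# → ev b u ≡ 0# → l ≡ 0#
          coefficient {a} {b} l m e {u} au≡1 bu≡0 = trans (sym (trans (ev-shiftˡ (shift zeroV l a) m b u)
              (trans (cong₂ (λ x y → x + m * y) (trans (ev-scaleˡ l a u) (trans (*-congˡ au≡1) (*-identityʳ l))) bu≡0)
                (solve 2 (λ l m → l :+ m :* con (+ 0) := l) refl l m))))
            (ev-zeroˡ (shift (shift zeroV l a) m b) u (λ r → trans (+-congʳ (+-identityˡ _)) (e r)))
        intersection : IsIntersectionOfHyperplanes A X
        intersection = (λ r → isYes (r ≟ᶠ i) ∨ isYes (r ≟ᶠ j)) , λ v → to v , from v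
          where
          to : ∀ v → X v → ∀ r → isYes (r ≟ᶠ i) ∨ isYes (r ≟ᶠ j) ≡ true → ev (α r) v ≡ 0#
          to v (αi≡0 , αj≡0) r _ with r ≟ᶠ i | r ≟ᶠ j
          to v (αi≡0 , αj≡0) r _  | yes refl | _ = αi≡0
          to v (αi≡0 , αj≡0) r _  | no _ | yes refl = αj≡0
          to v (αi≡0 , αj≡0) r () | no _ | no _
          from : ∀ v → (∀ r → isYes (r ≟ᶠ i) ∨ isYes (r ≟ᶠ j) ≡ true → ev (α r) v ≡ 0#) → X v
          from v h = h i at-i , h j at-j
            where
            at-i : isYes (i ≟ᶠ i) ∨ isYes (i ≟ᶠ j) ≡ true
            at-i with i ≟ᶠ i
            ... | yes _ = refl
            ... | no i≢i = contradiction refl i≢i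
            at-j : isYes (j ≟ᶠ i) ∨ isYes (j ≟ᶠ j) ≡ true
            at-j with j ≟ᶠ i | j ≟ᶠ j
            ... | yes _ | _ = refl
            ... | no _ | yes _ = refl
            ... | no _ | no j≢j = contradiction refl j≢j
        not-contained : ¬ ContainedIn A X k
        not-contained Xk with G X codim2 intersection
        ... | i′ , j′ , _ , _ , _ , only
            with only i (λ v z → proj₁ z) | only j (λ v z → proj₂ z) | only k Xk
        ... | inj₁ refl | _         | inj₁ k≡i = k≢i k≡i
        ... | inj₁ refl | inj₁ j≡i  | _        = i≢j (sym j≡i)
        ... | inj₁ refl | inj₂ refl | inj₂ k≡j = k≢j k≡j
        ... | inj₂ refl | _         | inj₂ k≡i = k≢i k≡i
        ... | inj₂ refl | inj₂ j≡i  | _        = i≢j (sym j≡i)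
        ... | inj₂ refl | inj₁ refl | inj₁ k≡j = k≢j k≡j

      generic-vector-on-square : GenericCodim2 A → ∀ {i j} → i ≢ j →
        Σ[ v ∈ Vect ℓ ] ((ev (α i) v ≡ 0#) × (ev (α j) v ≡ 0#))
                      × (∀ k → ((k ≡ i) ⊎ (k ≡ j)) ⊎ (ev (α k) v ≢ 0#))
      generic-vector-on-square G {i} {j} i≢j = generic-vector X (ev-zeroʳ (α i) , ev-zeroʳ (α j))
        (λ v t w (vi , vj) (wi , wj) → kernel-shift (α i) v t w vi wi , kernel-shift (α j) v t w vj wj)
        n α (λ k → (k ≡ i) ⊎ (k ≡ j)) off
        where
        X : Vect ℓ → Set
        X v = (ev (α i) v ≡ 0#) × (ev (α j) v ≡ 0#)
        off : ∀ k → ((k ≡ i) ⊎ (k ≡ j)) ⊎ (Σ[ w ∈ Vect ℓ ] X w × (ev (α k) w ≢ 0#))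
        off k with k ≟ᶠ i | k ≟ᶠ j
        ... | yes k≡i | _ = inj₁ (inj₁ k≡i)
        ... | no _ | yes k≡j = inj₁ (inj₂ k≡j)
        ... | no k≢i | no k≢j = inj₂ (generic⇒avoids G i≢j k k≢i k≢j)

      -- The four chambers around a generic point of the intersection. As `u` and `w` are dual to
      -- `α i` and `α j`, the direction `d s t` prescribes these two signs independently, while
      -- every other hyperplane misses the point and keeps its sign.
      square : GenericCodim2 A → ∀ {i j} → i ≢ j → Σ[ p ∈ (Bool → Bool → Point A) ]
        ((∀ s t → pattern-of (p s t) i ≡ s) × (∀ s t → pattern-of (p s t) j ≡ t)
        × (∀ k → k ≢ i → k ≢ j → ∀ s t s′ t′ → pattern-of (p s t) k ≡ pattern-of (p s′ t′) k))
      square G {i} {j} i≢j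
        with generic-vector-on-square G i≢j | independent (≢-sym i≢j) | independent i≢j
      ... | v , (vi , vj) , generic | u , αju≡0 , αiu≡1 | w , αiw≡0 , αjw≡1 =
        (λ s t → proj₁ (near s t)) , on-i , on-j , off-walls
        where
        d : Bool → Bool → Vect ℓ
        d s t = shift (shift zeroV (sign s) u) (sign t) w
        ev-d : ∀ k s t → ev (α k) (d s t) ≡ sign s * ev (α k) u + sign t * ev (α k) w
        ev-d k s t = trans (ev-shiftʳ (α k) _ (sign t) w) (+-congʳ (ev-scaleʳ (α k) (sign s) u))
        αid : ∀ s t → ev (α i) (d s t) ≡ sign s
        αid s t = trans (ev-d i s t) (trans
          (cong₂ (λ x y → sign s * x + sign t * y) αiu≡1 αiw≡0)
          (solve 2 (λ x y → x :* con (+ 1) :+ y :* con (+ 0) := x) refl (sign s) (sign t)))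
        αjd : ∀ s t → ev (α j) (d s t) ≡ sign t
        αjd s t = trans (ev-d j s t) (trans
          (cong₂ (λ x y → sign s * x + sign t * y) αju≡0 αjw≡1)
          (solve 2 (λ x y → x :* con (+ 0) :+ y :* con (+ 1) := y) refl (sign s) (sign t)))
        αid≢0 : ∀ s t → ev (α i) (d s t) ≢ 0#
        αid≢0 s t = subst (_≢ 0#) (sym (αid s t)) (sign≢0 s)
        αjd≢0 : ∀ s t → ev (α j) (d s t) ≢ 0#
        αjd≢0 s t = subst (_≢ 0#) (sym (αjd s t)) (sign≢0 t)
        near : ∀ s t → Σ[ p ∈ Point A ] Near v (d s t) p
        near s t = point-near v (d s t) λ k →
          [ [ (λ { refl → inj₂ (vi , αid≢0 s t) }) , (λ { refl → inj₂ (vj , αjd≢0 s t) }) ]′ , inj₁ ]′ (generic k)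
        on-i : ∀ s t → pattern-of (proj₁ (near s t)) i ≡ s
        on-i s t = trans (proj₂ (proj₂ (near s t) i) vi (αid≢0 s t)) (trans (cong pos (αid s t)) (pos-sign s))
        on-j : ∀ s t → pattern-of (proj₁ (near s t)) j ≡ t
        on-j s t = trans (proj₂ (proj₂ (near s t) j) vj (αjd≢0 s t)) (trans (cong pos (αjd s t)) (pos-sign t))
        off-walls : ∀ k → k ≢ i → k ≢ j → ∀ s t s′ t′ →
          pattern-of (proj₁ (near s t)) k ≡ pattern-of (proj₁ (near s′ t′)) k
        off-walls k k≢i k≢j s t s′ t′ with generic k
        ... | inj₁ (inj₁ k≡i) = contradiction k≡i k≢i
        ... | inj₁ (inj₂ k≡j) = contradiction k≡j k≢j
        ... | inj₂ v≢0 = trans (proj₁ (proj₂ (near s t) k) v≢0) (sym (proj₁ (proj₂ (near s′ t′) k) v≢0))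

-- Idempotents of an integral domain.

module Bits {c ℓr} (R : CommutativeRing c ℓr) (domain : IsIntegralDomain R) where
  open CommutativeRing R hiding (zero; ring) renaming (refl to ≈-refl; sym to ≈-sym; trans to ≈-trans)
  open Algebra.Properties.Ring (CommutativeRing.ring R) using (x∙y⁻¹≈ε⇒x≈y; x[y-z]≈xy-xz)

  1≉0 : ¬ (1# ≈ 0#)
  1≉0 = proj₁ domain

  bit : Bool → Carrier
  bit true  = 1#
  bit false = 0#

  bit-injective : ∀ {s t} → bit s ≈ bit t → s ≡ t
  bit-injective {true}  {true}  _ = refl
  bit-injective {false} {false} _ = refl
  bit-injective {true}  {false} e = contradiction e 1≉0
  bit-injective {false} {true}  e = contradiction (≈-sym e) 1≉0

  bit-cong : ∀ {s t} → s ≡ t → bit s ≈ bit t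
  bit-cong refl = ≈-refl

  bit-idempotent : ∀ s → bit s * bit s ≈ bit s
  bit-idempotent true  = *-identityˡ 1#
  bit-idempotent false = zeroˡ 0#

  -- Factor as `x * (x - 1#)`. The domain property returns an actual disjunction, so this decides
  -- the value of an idempotent.
  idempotent⇒bit : ∀ {x} → x * x ≈ x → (x ≈ 1#) ⊎ (x ≈ 0#)
  idempotent⇒bit {x} xx≈x with proj₂ domain x (x - 1#)
    (≈-trans (x[y-z]≈xy-xz x x 1#) (≈-trans (+-cong xx≈x (-‿cong (*-identityʳ x))) (-‿inverseʳ x)))
  ... | inj₁ x≈0   = inj₂ x≈0
  ... | inj₂ x-1≈0 = inj₁ (x∙y⁻¹≈ε⇒x≈y x 1# x-1≈0)

-- Polynomials of degree at most one on the Boolean cube.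

module Polynomials {c ℓr} (R : CommutativeRing c ℓr) where
  open CommutativeRing R hiding (zero; ring) renaming (refl to ≈-refl; sym to ≈-sym; trans to ≈-trans)
  open import Relation.Binary.Reasoning.Setoid setoid

  eval-cong : ∀ {n} (G : Poly Carrier n) {z w : Fin n → Carrier} → (∀ k → z k ≈ w k) →
    evalPoly R G z ≈ evalPoly R G w
  eval-cong (con a)   z≈w = ≈-refl
  eval-cong (var k)   z≈w = z≈w k
  eval-cong (G ⊕ H) z≈w = +-cong (eval-cong G z≈w) (eval-cong H z≈w)
  eval-cong (G ⊗ H) z≈w = *-cong (eval-cong G z≈w) (eval-cong H z≈w)

  deg0⇒constant : ∀ {n} (G : Poly Carrier n) → deg G ≤ℕ 0 → ∀ z w → evalPoly R G z ≈ evalPoly R G w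
  deg0⇒constant (con a) _ z w = ≈-refl
  deg0⇒constant (G ⊕ H) d z w = +-cong (deg0⇒constant G (m⊔n≤o⇒m≤o (deg G) (deg H) d) z w)
                                       (deg0⇒constant H (m⊔n≤o⇒n≤o (deg G) (deg H) d) z w)
  deg0⇒constant (G ⊗ H) d z w = *-cong (deg0⇒constant G (m+n≤o⇒m≤o (deg G) d) z w)
                                       (deg0⇒constant H (m+n≤o⇒n≤o (deg G) d) z w)

  +≤1 : ∀ {m n} → m +ℕ n ≤ℕ 1 → ((m ≤ℕ 0) × (n ≤ℕ 1)) ⊎ ((m ≤ℕ 1) × (n ≤ℕ 0))
  +≤1 {zero}  n≤1 = inj₁ (z≤n , n≤1)
  +≤1 {suc m} (s≤s m+n≤0) = inj₂ (s≤s (m+n≤o⇒m≤o m m+n≤0) , m+n≤o⇒n≤o m m+n≤0)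

  -- Affineness as a parallelogram identity, which passes through syntax trees by induction: a
  -- product of degree at most 1 has a factor of degree 0, which is constant and can be pulled out.
  deg1⇒affine : ∀ {n} (G : Poly Carrier n) → deg G ≤ℕ 1 → ∀ z z′ w w′ →
    (∀ k → z k + w′ k ≈ z′ k + w k) →
    evalPoly R G z + evalPoly R G w′ ≈ evalPoly R G z′ + evalPoly R G w
  deg1⇒affine (con a) d z z′ w w′ e = ≈-refl
  deg1⇒affine (var k) d z z′ w w′ e = e k
  deg1⇒affine (G ⊕ H) d z z′ w w′ e = begin
    (G[ z ] + H[ z ]) + (G[ w′ ] + H[ w′ ]) ≈⟨ interchange _ _ _ _ ⟩
    (G[ z ] + G[ w′ ]) + (H[ z ] + H[ w′ ]) ≈⟨ +-cong
      (deg1⇒affine G (m⊔n≤o⇒m≤o (deg G) (deg H) d) z z′ w w′ e)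
      (deg1⇒affine H (m⊔n≤o⇒n≤o (deg G) (deg H) d) z z′ w w′ e) ⟩
    (G[ z′ ] + G[ w ]) + (H[ z′ ] + H[ w ]) ≈⟨ interchange _ _ _ _ ⟩
    (G[ z′ ] + H[ z′ ]) + (G[ w ] + H[ w ]) ∎
    where
    open import Algebra.Properties.CommutativeSemigroup
      (CommutativeRing.+-commutativeSemigroup R) using (interchange)
    G[_] H[_] : (Fin _ → Carrier) → Carrier
    G[ z ] = evalPoly R G z
    H[ z ] = evalPoly R H z
  deg1⇒affine (G ⊗ H) d z z′ w w′ e with +≤1 {deg G} d
  ... | inj₁ (G≤0 , H≤1) = begin
    G[ z ] * H[ z ] + G[ w′ ] * H[ w′ ] ≈⟨ +-congˡ (*-congʳ (deg0⇒constant G G≤0 w′ z)) ⟩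
    G[ z ] * H[ z ] + G[ z ] * H[ w′ ]  ≈⟨ distribˡ _ _ _ ⟨
    G[ z ] * (H[ z ] + H[ w′ ])         ≈⟨ *-congˡ (deg1⇒affine H H≤1 z z′ w w′ e) ⟩
    G[ z ] * (H[ z′ ] + H[ w ])         ≈⟨ distribˡ _ _ _ ⟩
    G[ z ] * H[ z′ ] + G[ z ] * H[ w ]  ≈⟨ +-cong (*-congʳ (deg0⇒constant G G≤0 z z′))
                                                  (*-congʳ (deg0⇒constant G G≤0 z w)) ⟩
    G[ z′ ] * H[ z′ ] + G[ w ] * H[ w ] ∎
    where
    G[_] H[_] : (Fin _ → Carrier) → Carrier
    G[ z ] = evalPoly R G z
    H[ z ] = evalPoly R H z
  ... | inj₂ (G≤1 , H≤0) = begin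
    G[ z ] * H[ z ] + G[ w′ ] * H[ w′ ] ≈⟨ +-congˡ (*-congˡ (deg0⇒constant H H≤0 w′ z)) ⟩
    G[ z ] * H[ z ] + G[ w′ ] * H[ z ]  ≈⟨ distribʳ _ _ _ ⟨
    (G[ z ] + G[ w′ ]) * H[ z ]         ≈⟨ *-congʳ (deg1⇒affine G G≤1 z z′ w w′ e) ⟩
    (G[ z′ ] + G[ w ]) * H[ z ]         ≈⟨ distribʳ _ _ _ ⟩
    G[ z′ ] * H[ z ] + G[ w ] * H[ z ]  ≈⟨ +-cong (*-congˡ (deg0⇒constant H H≤0 z z′))
                                                  (*-congˡ (deg0⇒constant H H≤0 z w)) ⟩
    G[ z′ ] * H[ z′ ] + G[ w ] * H[ w ] ∎
    where
    G[_] H[_] : (Fin _ → Carrier) → Carrier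
    G[ z ] = evalPoly R G z
    H[ z ] = evalPoly R H z

  Insensitive : ∀ {n} → ((Fin n → Bool) → Carrier) → Fin n → Set ℓr
  Insensitive F k = ∀ u u′ → (∀ l → l ≢ k → u l ≡ u′ l) → F u ≈ F u′

  -- Passes from `s` to `t` one coordinate at a time. Intermediate vectors need not be patterns of
  -- chambers, which is why `F` is taken on the full cube.
  insensitive⇒≈ : ∀ n (F : (Fin n → Bool) → Carrier) → (∀ s t → (∀ k → s k ≡ t k) → F s ≈ F t) →
    ∀ s t → (∀ k → (s k ≡ t k) ⊎ Insensitive F k) → F s ≈ F t
  insensitive⇒≈ zero F F-cong s t H = F-cong s t λ ()
  insensitive⇒≈ (suc n) F F-cong s t H = ≈-trans first (≈-trans
    (insensitive⇒≈ n (F ∘ (t zero ∷_))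
      (λ u v u≗v → F-cong (t zero ∷ u) (t zero ∷ v) λ { zero → refl ; (suc k) → u≗v k })
      (s ∘ suc) (t ∘ suc) rest)
    (F-cong (t zero ∷ (t ∘ suc)) t λ { zero → refl ; (suc k) → refl }))
    where
    first : F s ≈ F (t zero ∷ (s ∘ suc))
    first with H zero
    ... | inj₁ s₀≡t₀ = F-cong s (t zero ∷ (s ∘ suc)) λ { zero → s₀≡t₀ ; (suc k) → refl }
    ... | inj₂ ins = ins s (t zero ∷ (s ∘ suc)) λ { zero 0≢0 → contradiction refl 0≢0 ; (suc k) _ → refl }
    rest : ∀ k → (s (suc k) ≡ t (suc k)) ⊎ Insensitive (F ∘ (t zero ∷_)) k
    rest k = map₂ (λ ins u u′ u≗u′ → ins (t zero ∷ u) (t zero ∷ u′) λ where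
      zero    _   → refl
      (suc l) l≢k → u≗u′ l (l≢k ∘ cong suc)) (H (suc k))

-- Elements of the Varchenko-Gelfand algebra and Boolean functions in Fil¹.

module VarchenkoGelfand (ℝ : RealModel) {c ℓr} (R : CommutativeRing c ℓr) (domain : IsIntegralDomain R) where
  open CommutativeRing R hiding (zero; ring) renaming (refl to ≈-refl; sym to ≈-sym; trans to ≈-trans)
  open Algebra.Properties.Ring (CommutativeRing.ring R) using (+-cancelˡ; +-cancelʳ)
  open Bits R domain
  open Polynomials R
  open Patterns ℝ
  open Arr ℝ using (Arrangement; Point; GenericCodim2)
  open Arr.VG ℝ R hiding (module R; _+ᵥ_; _*ᵥ_; _·ᵥ_)

  module _ {ℓ n : ℕ} (A : Arrangement ℓ n) where

    xplus≡bit : ∀ i p → xplus A i p ≡ bit (pattern-of A p i)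
    xplus≡bit i p = heaviside≡bit (RealModel.compare ℝ _ _)
      where
      heaviside≡bit : ∀ {x} t → heaviside A {x} t ≡ bit (OrderedField.positive ℝ t)
      heaviside≡bit (tri< _ _ _) = refl
      heaviside≡bit (tri≈ _ _ _) = refl
      heaviside≡bit (tri> _ _ _) = refl

    coordinate : Fin n → VGElt A
    coordinate i = record
      { fun  = λ p → bit (pattern-of A p i)
      ; resp = λ p q p~q → bit-cong (chamber⇒pattern A p q p~q i)
      }

    coordinate-InFil : ∀ i → InFil A 1 (coordinate i)
    coordinate-InFil i = var i , ≤-refl , λ p → reflexive (sym (xplus≡bit i p))

    same-pattern? : ∀ p q → Dec (∀ k → pattern-of A p k ≡ pattern-of A q k)
    same-pattern? p q = all? λ k → pattern-of A p k ≟ᵇ pattern-of A q k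

    same : Point A → Point A → Bool
    same p q = isYes (same-pattern? p q)

    same⇒pattern : ∀ p q → same p q ≡ true → ∀ k → pattern-of A p k ≡ pattern-of A q k
    same⇒pattern p q _ with same-pattern? p q
    same⇒pattern p q _  | yes p~q = p~q
    same⇒pattern p q () | no _

    pattern⇒same : ∀ p q → (∀ k → pattern-of A p k ≡ pattern-of A q k) → same p q ≡ true
    pattern⇒same p q p~q with same-pattern? p q
    ... | yes _ = refl
    ... | no p≁q = contradiction p~q p≁q

    same-respects : ∀ p q r → (∀ k → pattern-of A q k ≡ pattern-of A r k) → same p q ≡ same p r
    same-respects p q r q~r with same-pattern? p q | same-pattern? p r
    ... | yes _   | yes _   = refl
    ... | no _    | no _    = refl
    ... | yes p~q | no p≁r  = contradiction (λ k → trans (p~q k) (q~r k)) p≁r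
    ... | no p≁q  | yes p~r = contradiction (λ k → trans (p~r k) (sym (q~r k))) p≁q

    indicator : Point A → VGElt A
    indicator p = record
      { fun  = λ q → bit (same p q)
      ; resp = λ q r q~r → bit-cong (same-respects p q r (chamber⇒pattern A q r q~r))
      }

    indicator-self : ∀ p → fun (indicator p) p ≈ 1#
    indicator-self p = bit-cong (pattern⇒same p p λ _ → refl)

    scaled-indicator : Carrier → Point A → VGElt A
    scaled-indicator a p = record
      { fun  = λ q → a * bit (same p q)
      ; resp = λ q r q~r → *-congˡ (resp (indicator p) q r q~r)
      }

    -- Multiplication by an indicator turns `f` into the scalar `fun f p`. This expresses evaluation
    -- at `p` through algebra operations that an isomorphism transports.
    indicator-absorbs : ∀ (f : VGElt A) p q → fun f p * bit (same p q) ≈ fun f q * bit (same p q)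
    indicator-absorbs f p q = absorb (same p q) refl
      where
      absorb : ∀ s → same p q ≡ s → fun f p * bit s ≈ fun f q * bit s
      absorb false _ = ≈-trans (zeroʳ _) (≈-sym (zeroʳ _))
      absorb true  e = *-congʳ (resp f p q (pattern⇒chamber A p q (same⇒pattern p q e)))

    abstract
      -- Runs through all Boolean vectors and, for each realizable one, inspects `e` at one witness;
      -- by `resp` the answer holds on the whole chamber.
      chamber-search : ∀ (e : VGElt A) → (∀ p → fun e p * fun e p ≈ fun e p) →
        (Σ[ p ∈ Point A ] fun e p ≈ 1#) ⊎ (∀ p → fun e p ≈ 0#)
      chamber-search e idem = decide (anySubset? λ s → at s (realizable? A (lookup s)))
        where
        Hit : (Fin n → Bool) → Set ℓr
        Hit s = Σ[ p ∈ Point A ] ((∀ k → pattern-of A p k ≡ s k) × (fun e p ≈ 1#))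
        at : ∀ s → Dec (Σ[ p ∈ Point A ] (∀ k → pattern-of A p k ≡ lookup s k)) → Dec (Hit (lookup s))
        at s (no ∄p) = no λ (p , p~s , _) → ∄p (p , p~s)
        at s (yes (p , p~s)) with idempotent⇒bit (idem p)
        ... | inj₁ ep≈1 = yes (p , p~s , ep≈1)
        ... | inj₂ ep≈0 = no λ (q , q~s , eq≈1) → 1≉0 (≈-trans (≈-sym eq≈1) (≈-trans
                (resp e q p (pattern⇒chamber A q p λ k → trans (q~s k) (sym (p~s k)))) ep≈0))
        decide : Dec (∃ λ s → Hit (lookup s)) → (Σ[ p ∈ Point A ] fun e p ≈ 1#) ⊎ (∀ p → fun e p ≈ 0#)
        decide (yes (_ , p , _ , ep≈1)) = inj₁ (p , ep≈1)
        decide (no ∄s) = inj₂ λ p → [ (λ ep≈1 → contradiction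
            (tabulate (pattern-of A p) , p , (λ k → sym (lookup∘tabulate (pattern-of A p) k)) , ep≈1) ∄s)
          , (λ ep≈0 → ep≈0) ]′ (idempotent⇒bit (idem p))

  -- Says that `b` is the i-th coordinate or its complement without choosing between them.
  SameFibres : ∀ {ℓ n} (A : Arrangement ℓ n) → (Point A → Bool) → Fin n → Set
  SameFibres A b i = ∀ p q → (b p ≡ b q → pattern-of A p i ≡ pattern-of A q i)
                           × (pattern-of A p i ≡ pattern-of A q i → b p ≡ b q)

  -- If b changed across two walls, then around their generic intersection, where no
  -- third hyperplane passes, affineness would give 1 + 1 ≈ 0 + 0.
  affine-Boolean⇒coordinate : CharNot2 R → ∀ {ℓ n} (A : Arrangement ℓ n) → GenericCodim2 A →
    (b : Point A → Bool) → ∀ f → InFil A 1 f → (∀ p → fun f p ≈ bit (b p)) →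
    ∀ p₀ q₀ → b p₀ ≢ b q₀ → Σ[ i ∈ Fin n ] SameFibres A b i
  affine-Boolean⇒coordinate 2≉0 {n = n} A generic b f (G , degG≤1 , f≈G) f≈b p₀ q₀ bp₀≢bq₀ =
    found (any? λ k → ¬? (b (w k true) ≟ᵇ b (w k false)))
    where
    F : (Fin n → Bool) → Carrier
    F s = evalPoly R G (bit ∘ s)

    pat : Point A → Fin n → Bool
    pat = pattern-of A

    w : Fin n → Bool → Point A
    w k = proj₁ (wall A k)
    w-on : ∀ k s → pat (w k s) k ≡ s
    w-on k = proj₁ (proj₂ (wall A k))
    w-off : ∀ k l → l ≢ k → ∀ s t → pat (w k s) l ≡ pat (w k t) l
    w-off k = proj₂ (proj₂ (wall A k))

    F-cong : ∀ s t → (∀ k → s k ≡ t k) → F s ≈ F t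
    F-cong s t s≗t = eval-cong G λ k → bit-cong (s≗t k)

    F≈b : ∀ p → F (pat p) ≈ bit (b p)
    F≈b p = ≈-trans (eval-cong G λ k → reflexive (sym (xplus≡bit A k p))) (≈-trans (≈-sym (f≈G p)) (f≈b p))

    F-affine : ∀ s s′ t t′ → (∀ k → ((s k ≡ s′ k) × (t′ k ≡ t k)) ⊎ ((s k ≡ t k) × (t′ k ≡ s′ k))) →
      F s + F t′ ≈ F s′ + F t
    F-affine s s′ t t′ H = deg1⇒affine G degG≤1 (bit ∘ s) (bit ∘ s′) (bit ∘ t) (bit ∘ t′) λ k →
      [ (λ (p , q) → +-cong (bit-cong p) (bit-cong q))
      , (λ (p , q) → ≈-trans (+-cong (bit-cong p) (bit-cong q)) (+-comm _ _)) ]′ (H k)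

    b-affine : ∀ p p′ q q′ → (∀ k → ((pat p k ≡ pat p′ k) × (pat q′ k ≡ pat q k))
                                  ⊎ ((pat p k ≡ pat q k) × (pat q′ k ≡ pat p′ k))) →
      bit (b p) + bit (b q′) ≈ bit (b p′) + bit (b q)
    b-affine p p′ q q′ H = ≈-trans (≈-sym (+-cong (F≈b p) (F≈b q′)))
      (≈-trans (F-affine (pat p) (pat p′) (pat q) (pat q′) H) (+-cong (F≈b p′) (F≈b q)))

    -- By affineness the jump of `F` in coordinate `k` is the same everywhere. At the two chambers
    -- adjacent across the k-th wall it is the jump of `b`, which is zero by assumption.
    insensitive : ∀ k → b (w k true) ≡ b (w k false) → Insensitive F k
    insensitive k e u u′ u≗u′ = +-cancelʳ (F (pat (w k (u′ k)))) (F u) (F u′)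
      (≈-trans (F-affine u u′ (pat (w k (u k))) (pat (w k (u′ k))) parallel) (+-congˡ level))
      where
      parallel : ∀ l → ((u l ≡ u′ l) × (pat (w k (u′ k)) l ≡ pat (w k (u k)) l))
                     ⊎ ((u l ≡ pat (w k (u k)) l) × (pat (w k (u′ k)) l ≡ u′ l))
      parallel l with l ≟ᶠ k
      ... | yes refl = inj₂ (sym (w-on k (u k)) , w-on k (u′ k))
      ... | no  l≢k  = inj₁ (u≗u′ l l≢k , w-off k l l≢k (u′ k) (u k))
      b-level : ∀ s t → b (w k s) ≡ b (w k t)
      b-level true  true  = refl
      b-level true  false = e
      b-level false true  = sym e
      b-level false false = refl
      level : F (pat (w k (u k))) ≈ F (pat (w k (u′ k)))
      level = ≈-trans (F≈b _) (≈-trans (bit-cong (b-level (u k) (u′ k))) (≈-sym (F≈b _)))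

    square-contradiction : ∀ {i j} → i ≢ j → b (w i true) ≢ b (w i false) → b (w j true) ≢ b (w j false) → ⊥
    square-contradiction {i} {j} i≢j bi≢ bj≢ with square A generic i≢j
    ... | q , on-i , on-j , off = clash (b (q true true)) (b (q false true)) (b (q true false)) (b (q false false))
          (cross-i true) (cross-j true) (cross-j false)
          (b-affine (q true true) (q false true) (q true false) (q false false) around)
      where
      -- The jump across the i-th hyperplane beside the square equals the jump at `wall A i`, which
      -- is nonzero.
      cross-i : ∀ t → b (q true t) ≢ b (q false t)
      cross-i t e = bi≢ (sym (bit-injective (+-cancelˡ (bit (b (q true t))) _ _
          (≈-trans (b-affine (q true t) (q false t) (w i true) (w i false) parallel)
                   (+-congʳ (bit-cong (sym e)))))))
        where
        parallel : ∀ k → ((pat (q true t) k ≡ pat (q false t) k) × (pat (w i false) k ≡ pat (w i true) k))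
                       ⊎ ((pat (q true t) k ≡ pat (w i true) k) × (pat (w i false) k ≡ pat (q false t) k))
        parallel k with k ≟ᶠ i | k ≟ᶠ j
        ... | yes refl | _ = inj₂ (trans (on-i true t) (sym (w-on i true)) , trans (w-on i false) (sym (on-i false t)))
        ... | no k≢i | yes refl = inj₁ (trans (on-j true t) (sym (on-j false t)) , w-off i k k≢i false true)
        ... | no k≢i | no k≢j = inj₁ (off k k≢i k≢j true t false t , w-off i k k≢i false true)
      cross-j : ∀ s → b (q s true) ≢ b (q s false)
      cross-j s e = bj≢ (sym (bit-injective (+-cancelˡ (bit (b (q s true))) _ _
          (≈-trans (b-affine (q s true) (q s false) (w j true) (w j false) parallel)
                   (+-congʳ (bit-cong (sym e)))))))
        where
        parallel : ∀ k → ((pat (q s true) k ≡ pat (q s false) k) × (pat (w j false) k ≡ pat (w j true) k))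
                       ⊎ ((pat (q s true) k ≡ pat (w j true) k) × (pat (w j false) k ≡ pat (q s false) k))
        parallel k with k ≟ᶠ i | k ≟ᶠ j
        ... | _ | yes refl = inj₂ (trans (on-j s true) (sym (w-on j true)) , trans (w-on j false) (sym (on-j s false)))
        ... | yes refl | no k≢j = inj₁ (trans (on-i s true) (sym (on-i s false)) , w-off j k k≢j false true)
        ... | no k≢i | no k≢j = inj₁ (off k k≢i k≢j s true s false , w-off j k k≢j false true)
      around : ∀ k → ((pat (q true true) k ≡ pat (q false true) k) × (pat (q false false) k ≡ pat (q true false) k))
                   ⊎ ((pat (q true true) k ≡ pat (q true false) k) × (pat (q false false) k ≡ pat (q false true) k))
      around k with k ≟ᶠ i | k ≟ᶠ j
      ... | yes refl | _ = inj₂ (trans (on-i true true) (sym (on-i true false)) ,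
                                 trans (on-i false false) (sym (on-i false true)))
      ... | no k≢i | yes refl = inj₁ (trans (on-j true true) (sym (on-j false true)) ,
                                       trans (on-j false false) (sym (on-j true false)))
      ... | no k≢i | no k≢j = inj₁ (off k k≢i k≢j true true false true , off k k≢i k≢j false false true false)
      -- Among two truth values the three inequalities force `s` and `sᵢⱼ` to agree and `sᵢ` and
      -- `sⱼ` to be their common opposite.
      clash : ∀ s sᵢ sⱼ sᵢⱼ → s ≢ sᵢ → s ≢ sⱼ → sᵢ ≢ sᵢⱼ → bit s + bit sᵢⱼ ≈ bit sᵢ + bit sⱼ → ⊥
      clash true  true  _     _     p _ _ _ = p refl
      clash true  false true  _     _ p _ _ = p refl
      clash true  false false true  _ _ _ e = 2≉0 (≈-trans e (+-identityˡ 0#))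
      clash true  false false false _ _ p _ = p refl
      clash false false _     _     p _ _ _ = p refl
      clash false true  false _     _ p _ _ = p refl
      clash false true  true  false _ _ _ e = 2≉0 (≈-trans (≈-sym e) (+-identityˡ 0#))
      clash false true  true  true  _ _ p _ = p refl

    found : Dec (∃ λ k → b (w k true) ≢ b (w k false)) → Σ[ i ∈ Fin n ] SameFibres A b i
    -- With no jump across any wall, `F` is constant on the cube, contrary to the two different
    -- values of `b`.
    found (no none) = contradiction (bit-injective (≈-trans (≈-sym (F≈b p₀)) (≈-trans
      (insensitive⇒≈ n F F-cong (pat p₀) (pat q₀) λ k → inj₂ (insensitive k
        (decidable-stable (b (w k true) ≟ᵇ b (w k false)) λ ne → none (k , ne))))
      (F≈b q₀)))) bp₀≢bq₀
    found (yes (i , bi≢)) = i , λ p q → reflect p q , preserve p q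
      where
      preserve : ∀ p q → pat p i ≡ pat q i → b p ≡ b q
      preserve p q e = bit-injective (≈-trans (≈-sym (F≈b p)) (≈-trans
        (insensitive⇒≈ n F F-cong (pat p) (pat q) at) (F≈b q)))
        where
        at : ∀ k → (pat p k ≡ pat q k) ⊎ Insensitive F k
        at k with k ≟ᶠ i
        ... | yes refl = inj₁ e
        ... | no  k≢i  = inj₂ (insensitive k (decidable-stable (b (w k true) ≟ᵇ b (w k false))
                           λ bk≢ → square-contradiction k≢i bk≢ bi≢))
      on-wall : ∀ p s → pat p i ≡ s → b p ≡ b (w i s)
      on-wall p s e = preserve p (w i s) (trans e (sym (w-on i s)))
      reflect : ∀ p q → b p ≡ b q → pat p i ≡ pat q i
      reflect p q e = same-side _ _ refl refl
        where
        same-side : ∀ s t → pat p i ≡ s → pat q i ≡ t → s ≡ t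
        same-side true  true  _  _  = refl
        same-side false false _  _  = refl
        same-side true  false ep eq = contradiction (trans (sym (on-wall p true ep)) (trans e (on-wall q false eq))) bi≢
        same-side false true  ep eq = contradiction (trans (sym (on-wall q true eq)) (trans (sym e) (on-wall p false ep))) bi≢

-- The chamber bijection and the hyperplane bijection.

module TopeGraph (ℝ : RealModel) {c ℓr} (R : CommutativeRing c ℓr) (domain : IsIntegralDomain R) where
  open CommutativeRing R hiding (zero; ring) renaming (refl to ≈-refl; sym to ≈-sym; trans to ≈-trans)
  open Bits R domain
  open Patterns ℝ
  open VarchenkoGelfand ℝ R domain
  open Arr ℝ using (Arrangement; Point; SameChamber; Adjacent; GenericCodim2; TopeGraphIso)
  open Arr.VG ℝ R hiding (module R; _+ᵥ_; _*ᵥ_; _·ᵥ_)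

  module _ {ℓ₁ n₁ ℓ₂ n₂} (A₁ : Arrangement ℓ₁ n₁) (A₂ : Arrangement ℓ₂ n₂)
           (iso : FilteredAlgIso A₁ A₂) where

    φ : VGElt A₁ → VGElt A₂
    φ = proj₁ iso

    φ-* : ∀ f g h → (∀ p → fun h p ≈ fun f p * fun g p) → ∀ p → fun (φ h) p ≈ fun (φ f) p * fun (φ g) p
    φ-* = let _ , _ , _ , φ-* , _ = iso in φ-*

    φ-· : ∀ r f h → (∀ p → fun h p ≈ r * fun f p) → ∀ p → fun (φ h) p ≈ r * fun (φ f) p
    φ-· = let _ , _ , _ , _ , φ-· , _ = iso in φ-·

    φ-injective : ∀ f g → (∀ p → fun (φ f) p ≈ fun (φ g) p) → ∀ p → fun f p ≈ fun g p
    φ-injective = let _ , _ , _ , _ , _ , _ , φ-injective , _ = iso in φ-injective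

    φ-surjective : ∀ g → Σ[ f ∈ VGElt A₁ ] (∀ p → fun (φ f) p ≈ fun g p)
    φ-surjective = let _ , _ , _ , _ , _ , _ , _ , φ-surjective , _ = iso in φ-surjective

    φ-Fil⁻¹ : ∀ k g → InFil A₂ k g → Σ[ f ∈ VGElt A₁ ] (InFil A₁ k f × (∀ p → fun (φ f) p ≈ fun g p))
    φ-Fil⁻¹ = let _ , _ , _ , _ , _ , _ , _ , _ , _ , φ-Fil⁻¹ = iso in φ-Fil⁻¹

    pat₁ : Point A₁ → Fin n₁ → Bool
    pat₁ = pattern-of A₁

    pat₂ : Point A₂ → Fin n₂ → Bool
    pat₂ = pattern-of A₂

    φ-zero : ∀ (e : VGElt A₁) → (∀ p → fun e p ≈ 0#) → ∀ q → fun (φ e) q ≈ 0#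
    φ-zero e e≈0 q = ≈-trans (φ-· 0# e e (λ p → ≈-trans (e≈0 p) (≈-sym (zeroˡ (fun e p)))) q) (zeroˡ (fun (φ e) q))

    abstract
      -- The image of the indicator of `p` is idempotent. Were it zero everywhere, injectivity would
      -- make the indicator zero, but it is 1 at `p`.
      support : ∀ p → Σ[ q ∈ Point A₂ ] fun (φ (indicator A₁ p)) q ≈ 1#
      support p = [ (λ q → q) , (λ φδ≈0 → contradiction (vanishes φδ≈0) 1≉0) ]′
        (chamber-search A₂ (φ δ) λ q → ≈-sym (φ-* δ δ δ (λ r → ≈-sym (bit-idempotent (same A₁ p r))) q))
        where
        δ 𝟘 : VGElt A₁
        δ = indicator A₁ p
        𝟘 = scaled-indicator A₁ 0# p
        vanishes : (∀ q → fun (φ δ) q ≈ 0#) → 1# ≈ 0#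
        vanishes φδ≈0 = ≈-trans (≈-sym (indicator-self A₁ p)) (≈-trans
          (φ-injective δ 𝟘 (λ q → ≈-trans (φδ≈0 q) (≈-sym (φ-zero 𝟘 (λ r → zeroˡ (fun δ r)) q))) p)
          (zeroˡ (fun δ p)))

    ψ : Point A₁ → Point A₂
    ψ p = proj₁ (support p)

    -- With δ the indicator of `p`, φ(f)φ(δ) = φ(fδ) = φ(f(p)δ) = f(p)φ(δ); evaluate at `ψ p`, where
    -- φ(δ) is 1.
    φ-at-ψ : ∀ (f : VGElt A₁) p → fun (φ f) (ψ p) ≈ fun f p
    φ-at-ψ f p = ≈-trans (≈-sym (times-one (fun (φ f) (ψ p)))) (≈-trans
      (≈-trans (≈-sym (φ-* f δ fδ (λ q → indicator-absorbs A₁ f p q) (ψ p)))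
               (φ-· (fun f p) δ fδ (λ q → ≈-refl) (ψ p)))
      (times-one (fun f p)))
      where
      δ fδ : VGElt A₁
      δ = indicator A₁ p
      fδ = scaled-indicator A₁ (fun f p) p
      times-one : ∀ x → x * fun (φ δ) (ψ p) ≈ x
      times-one x = ≈-trans (*-congˡ (proj₂ (support p))) (*-identityʳ x)

    -- `ψ p` is the outcome of a search started from a point, so independence of that point must be
    -- shown. Each coordinate of `A₂` is some φ(f), whose value at `ψ p` is the value of `f` on the
    -- chamber of `p`.
    ψ-preserves : ∀ p q → SameChamber A₁ p q → SameChamber A₂ (ψ p) (ψ q)
    ψ-preserves p q p~q = pattern⇒chamber A₂ (ψ p) (ψ q) λ k → bit-injective (same-coordinate k)
      where
      same-coordinate : ∀ k → bit (pat₂ (ψ p) k) ≈ bit (pat₂ (ψ q) k)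
      same-coordinate k with φ-surjective (coordinate A₂ k)
      ... | f , φf≈x = ≈-trans (≈-sym (φf≈x (ψ p))) (≈-trans (φ-at-ψ f p) (≈-trans (resp f p q p~q)
              (≈-trans (≈-sym (φ-at-ψ f q)) (φf≈x (ψ q)))))

    ψ-reflects : ∀ p q → SameChamber A₂ (ψ p) (ψ q) → SameChamber A₁ p q
    ψ-reflects p q ψp~ψq = pattern⇒chamber A₁ p q λ k → bit-injective (same-coordinate k)
      where
      same-coordinate : ∀ k → bit (pat₁ p k) ≈ bit (pat₁ q k)
      same-coordinate k = ≈-trans (≈-sym (φ-at-ψ x p))
        (≈-trans (resp (φ x) (ψ p) (ψ q) ψp~ψq) (φ-at-ψ x q))
        where
        x : VGElt A₁
        x = coordinate A₁ k

    abstract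
      -- The preimage `e` of the indicator of `r` is that indicator composed with ψ. It is
      -- idempotent and nonzero, and any point where it is 1 is mapped into the chamber of `r`.
      ψ-surjective : ∀ r → Σ[ p ∈ Point A₁ ] SameChamber A₂ (ψ p) r
      ψ-surjective r = preimage (chamber-search A₁ e idempotent)
        where
        e : VGElt A₁
        e = proj₁ (φ-surjective (indicator A₂ r))
        φe≈δ : ∀ q → fun (φ e) q ≈ bit (same A₂ r q)
        φe≈δ = proj₂ (φ-surjective (indicator A₂ r))
        e≈δψ : ∀ p → fun e p ≈ bit (same A₂ r (ψ p))
        e≈δψ p = ≈-trans (≈-sym (φ-at-ψ e p)) (φe≈δ (ψ p))
        idempotent : ∀ p → fun e p * fun e p ≈ fun e p
        idempotent p = ≈-trans (*-cong (e≈δψ p) (e≈δψ p)) (≈-trans (bit-idempotent (same A₂ r (ψ p))) (≈-sym (e≈δψ p)))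
        preimage : (Σ[ p ∈ Point A₁ ] fun e p ≈ 1#) ⊎ (∀ p → fun e p ≈ 0#) →
                   Σ[ p ∈ Point A₁ ] SameChamber A₂ (ψ p) r
        preimage (inj₁ (p , ep≈1)) = p , pattern⇒chamber A₂ (ψ p) r λ k →
          sym (same⇒pattern A₂ r (ψ p) (bit-injective (≈-trans (≈-sym (e≈δψ p)) ep≈1)) k)
        preimage (inj₂ e≈0) = contradiction
          (≈-trans (≈-sym (indicator-self A₂ r)) (≈-trans (≈-sym (φe≈δ r)) (φ-zero e e≈0 r))) 1≉0

    module _ (2≉0 : CharNot2 R) (generic : GenericCodim2 A₁) where

      -- Preimages of two chambers of `A₂` adjacent across the j-th hyperplane: a test pair on
      -- which, among the pulled-back coordinates, exactly the j-th changes.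
      wall-lift : Fin n₂ → Bool → Point A₁
      wall-lift j s = proj₁ (ψ-surjective (proj₁ (wall A₂ j) s))

      wall-lift-pattern : ∀ j s k → pat₂ (ψ (wall-lift j s)) k ≡ pat₂ (proj₁ (wall A₂ j) s) k
      wall-lift-pattern j s = chamber⇒pattern A₂ (ψ (wall-lift j s)) (proj₁ (wall A₂ j) s)
        (proj₂ (ψ-surjective (proj₁ (wall A₂ j) s)))

      wall-lift-on : ∀ j s → pat₂ (ψ (wall-lift j s)) j ≡ s
      wall-lift-on j s = trans (wall-lift-pattern j s j) (proj₁ (proj₂ (wall A₂ j)) s)

      wall-lift-crosses : ∀ j → pat₂ (ψ (wall-lift j true)) j ≢ pat₂ (ψ (wall-lift j false)) j
      wall-lift-crosses j e = contradiction (trans (sym (wall-lift-on j true)) (trans e (wall-lift-on j false))) λ ()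

      wall-lift-off : ∀ j k → k ≢ j → pat₂ (ψ (wall-lift j true)) k ≡ pat₂ (ψ (wall-lift j false)) k
      wall-lift-off j k k≢j = trans (wall-lift-pattern j true k)
        (trans (proj₂ (proj₂ (wall A₂ j)) k k≢j true false) (sym (wall-lift-pattern j false k)))

      abstract
        -- The j-th coordinate lies in Fil¹, hence is φ(f) with `f` in Fil¹ of `A₁`. By `φ-at-ψ`
        -- this `f` is the coordinate composed with ψ, a Boolean function that is nonconstant by the
        -- test pair `wall-lift`.
        coordinate-pullback : ∀ j → Σ[ i ∈ Fin n₁ ] SameFibres A₁ (λ p → pat₂ (ψ p) j) i
        coordinate-pullback j = pullback (φ-Fil⁻¹ 1 (coordinate A₂ j) (coordinate-InFil A₂ j))
          where
          pullback : Σ[ f ∈ VGElt A₁ ] (InFil A₁ 1 f × (∀ q → fun (φ f) q ≈ bit (pat₂ q j))) →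
                     Σ[ i ∈ Fin n₁ ] SameFibres A₁ (λ p → pat₂ (ψ p) j) i
          pullback (f , f∈Fil , φf≈x) = affine-Boolean⇒coordinate 2≉0 A₁ generic (λ p → pat₂ (ψ p) j) f f∈Fil
            (λ p → ≈-trans (≈-sym (φ-at-ψ f p)) (φf≈x (ψ p)))
            (wall-lift j true) (wall-lift j false) (wall-lift-crosses j)

      σ : Fin n₂ → Fin n₁
      σ j = proj₁ (coordinate-pullback j)

      σ-fibres : ∀ j → SameFibres A₁ (λ p → pat₂ (ψ p) j) (σ j)
      σ-fibres j = proj₂ (coordinate-pullback j)

      -- The test pair for `j` agrees in coordinate `k`, so it lies on one side of the hyperplane
      -- `σ k`. If that were also `σ j`, the pair would agree in coordinate `j`.
      σ-injective : ∀ {j k} → σ j ≡ σ k → j ≡ k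
      σ-injective {j} {k} σj≡σk with k ≟ᶠ j
      ... | yes k≡j = sym k≡j
      ... | no  k≢j = contradiction (proj₂ (σ-fibres j p q)
          (subst (λ i → pat₁ p i ≡ pat₁ q i) (sym σj≡σk) (proj₁ (σ-fibres k p q) (wall-lift-off j k k≢j))))
        (wall-lift-crosses j)
        where
        p q : Point A₁
        p = wall-lift j true
        q = wall-lift j false

      -- If `i` were missed, the two chambers adjacent across the i-th wall of `A₁` would lie on the
      -- same side of every `σ j`. Then ψ would send them to one chamber, against `ψ-reflects`.
      σ-surjective : ∀ i → Σ[ j ∈ Fin n₂ ] σ j ≡ i
      σ-surjective i with any? (λ j → σ j ≟ᶠ i)
      ... | yes j = j
      ... | no ∄j = contradiction
          (trans (sym (proj₁ (proj₂ (wall A₁ i)) true)) (trans same-i (proj₁ (proj₂ (wall A₁ i)) false)))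
          λ ()
        where
        p q : Point A₁
        p = proj₁ (wall A₁ i) true
        q = proj₁ (wall A₁ i) false
        same-i : pat₁ p i ≡ pat₁ q i
        same-i = chamber⇒pattern A₁ p q (ψ-reflects p q (pattern⇒chamber A₂ (ψ p) (ψ q) λ j →
          proj₂ (σ-fibres j p q) (proj₂ (proj₂ (wall A₁ i)) (σ j) (λ σj≡i → ∄j (j , σj≡i)) true false))) i

      adjacent-preserves : ∀ p q → Adjacent A₁ p q → Adjacent A₂ (ψ p) (ψ q)
      adjacent-preserves p q (i , sep , only) with σ-surjective i
      ... | j , refl = j ,
        ≢⇒separates A₂ j (ψ p) (ψ q) (separates⇒≢ A₁ i p q sep ∘ proj₁ (σ-fibres j p q)) ,
        λ k sep-k → σ-injective (only (σ k) (≢⇒separates A₁ (σ k) p q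
          (separates⇒≢ A₂ k (ψ p) (ψ q) sep-k ∘ proj₂ (σ-fibres k p q))))

      adjacent-reflects : ∀ p q → Adjacent A₂ (ψ p) (ψ q) → Adjacent A₁ p q
      adjacent-reflects p q (j , sep , only) = σ j ,
        ≢⇒separates A₁ (σ j) p q (separates⇒≢ A₂ j (ψ p) (ψ q) sep ∘ proj₂ (σ-fibres j p q)) , only₁
        where
        only₁ : ∀ i → Arr.Separates ℝ A₁ i p q → i ≡ σ j
        only₁ i sep-i with σ-surjective i
        ... | k , refl = cong σ (only k (≢⇒separates A₂ k (ψ p) (ψ q)
                (separates⇒≢ A₁ (σ k) p q sep-i ∘ proj₁ (σ-fibres k p q))))

      ψ-isomorphism : TopeGraphIso A₁ A₂
      ψ-isomorphism = ψ , ψ-preserves , ψ-reflects , ψ-surjective ,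
        λ p q → adjacent-preserves p q , adjacent-reflects p q

theorem3p6 : (ℝ : RealModel) → ∀ {c ℓr} (R : CommutativeRing c ℓr) →
    IsIntegralDomain R → CharNot2 R →
    ∀ {ℓ₁ n₁ ℓ₂ n₂} (A₁ : Arr.Arrangement ℝ ℓ₁ n₁) (A₂ : Arr.Arrangement ℝ ℓ₂ n₂) →
    Arr.GenericCodim2 ℝ A₁ →
    Arr.VG.FilteredAlgIso ℝ R A₁ A₂ →
    Arr.TopeGraphIso ℝ A₁ A₂
theorem3p6 ℝ R domain 2≉0 A₁ A₂ generic iso =
  TopeGraph.ψ-isomorphism ℝ R domain A₁ A₂ iso 2≉0 generic
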